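{- Let $m\geqslant 4$ and $k\geqslant 3$ be integers, and for each $i\in\{0,1,\dots,m-1\}$ let $G_i$ be a $k$-regular $k$-edge-connected graph of order $n$ without triangles. If $n>\left\lceil\frac{3k+2}{2}\right\rceil$, then $G=G(G_0,G_1,\dots,G_{m-1};\mathscr{M})$ is super-$\lambda''$ and $\rho'(G)=k+1$, where $\mathscr{M}$ is any union of perfect matchings as described in the context.
   Context: All graphs are finite and simple. Let $G_0,\dots,G_{m-1}$ be $m\geqslant 3$ graphs with the same number of vertices (on pairwise disjoint vertex-sets). For each $i$, let $M_{i,i+1 (\mathrm{mod}\ m)}$ be an arbitrary perfect matching between $V(G_i)$ and $V(G_{i+1 (\mathrm{mod}\ m)})$ (its edges realize a bijection between the two vertex-sets), and let $\mathscr{M}=\bigcup_{i=0}^{m-1}M_{i,i+1 (\mathrm{mod}\ m)}$. Then $G(G_0,G_1,\dots,G_{m-1};\mathscr{M})$ is the graph with vertex-set $V(G_0)\cup\cdots\cup V(G_{m-1})$ and edge-set $E(G_0)\cup\cdots\cup E(G_{m-1})\cup\mathscr{M}$. For a connected graph $G=(V,E)$ and an integer $h\geqslant 0$, a set $F\subseteq E(G)$ is an $h$-extra edge-cut if $G-F$ is disconnected and every component of $G-F$ has more than $h$ vertices. If such a set exists, $\lambda^{(h)}(G)$ is the minimum cardinality of an $h$-extra edge-cut, and $G$ is called $\lambda^{(h)}$-connected. A $\lambda^{(h)}$-cut is an $h$-extra edge-cut of cardinality $\lambda^{(h)}(G)$. Write $\lambda'=\lambda^{(1)}$ and $\lambda''=\lambda^{(2)}$.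 For $X\subset V(G)$, $d_G(X)$ is the number of edges between $X$ and $V(G)\setminus X$, and $\xi_h(G)=\min\{d_G(X): X\subset V(G),\ |X|=h+1,\ G[X]\text{ connected}\}$. A $\lambda^{(h)}$-connected graph $G$ is $\lambda^{(h)}$-optimal if $\lambda^{(h)}(G)=\xi_h(G)$, and it is super-$\lambda^{(h)}$ if it is $\lambda^{(h)}$-optimal and, for every $\lambda^{(h)}$-cut $F$ of $G$, some component of $G-F$ has exactly $h+1$ vertices. Super-$\lambda'$ and super-$\lambda''$ are the cases $h=1,2$. A disconnected graph is not super-$\lambda^{(h)}$. For a super-$\lambda'$ graph $G$, the persistence $\rho'(G)$ is the maximum integer $r$ such that $G-F$ is still super-$\lambda'$ for every $F\subseteq E(G)$ with $|F|\leqslant r$. Any assertion about $\rho'(G)$ includes the assertion that $G$ is super-$\lambda'$. -}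

module Defs where

open import Data.Bool.Base using (if_then_else_)
open import Data.Fin.Base using (Fin; toℕ; remQuot)
open import Data.Fin.Permutation using (Permutation′; _⟨$⟩ʳ_)
open import Data.Fin.Properties using (toℕ-fromℕ<; toℕ<n) renaming (_≟_ to _≟ᶠ_; _<?_ to _<?ᶠ_)
open import Data.Fin.Subset using (Subset; _∈_; ∣_∣)
open import Data.Fin.Subset.Properties using (_∈?_)
open import Data.Nat.Base using (ℕ; suc; _*_; _≤_; _<_; _%_; s≤s)
open import Data.Nat.DivMod using (_mod_; m%n<n; m<n⇒m%n≡m; n%n≡0)
open import Data.Nat.Properties using (+-0-commutativeMonoid; m≤n⇒m<n∨m≡n; 1+n≢n)
open import Data.Product.Base using (Σ-syntax; ∃-syntax; _×_; _,_)
open import Data.Sum.Base using (_⊎_; inj₁; inj₂)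
open import Function.Bundles using (_⇔_)
open import Level using (0ℓ)
open import Relation.Binary.Construct.Closure.ReflexiveTransitive using (Star)
open import Relation.Binary.Core using (Rel)
open import Relation.Binary.Definitions using (Decidable; Symmetric)
open import Relation.Binary.PropositionalEquality.Core using (_≡_; _≢_; refl; sym; trans; cong)
open import Relation.Nullary.Decidable.Core using (Dec; does; ¬?; _×-dec_; _⊎-dec_)
open import Relation.Nullary.Negation.Core using (¬_)

open import Algebra.Properties.CommutativeMonoid.Sum +-0-commutativeMonoid
  using (sum-syntax)

record Graph (n : ℕ) : Set₁ where
  field
    Adj        : Rel (Fin n) 0ℓ
    adj?       : Decidable Adj
    adj-sym    : Symmetric Adj
    adj-irrefl : ∀ u → ¬ Adj u u

open Graph public

𝟙 : {P : Set} → Dec P → ℕ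
𝟙 P? = if does P? then 1 else 0

degree : ∀ {n} → Graph n → Fin n → ℕ
degree {n} G u = ∑[ v < n ] 𝟙 (adj? G u v)

Regular : ∀ {n} → ℕ → Graph n → Set
Regular k G = ∀ u → degree G u ≡ k

TriangleFree : ∀ {n} → Graph n → Set
TriangleFree G = ∀ u v w → ¬ (Adj G u v × Adj G v w × Adj G u w)

-- A set F of edges of G is represented by the spanning subgraph of G whose
-- edges are exactly the members of F, so that size F is the cardinality of F.

EdgeSet : ℕ → Set₁
EdgeSet = Graph

infix 4 _⊆ᴱ_
_⊆ᴱ_ : ∀ {n} → EdgeSet n → Graph n → Set
F ⊆ᴱ G = ∀ {u v} → Adj F u v → Adj G u v

-- Each edge is counted once, at its orientation from smaller to larger endpoint.

size : ∀ {n} → EdgeSet n → ℕ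
size {n} F = ∑[ u < n ] ∑[ v < n ] 𝟙 ((u <?ᶠ v) ×-dec adj? F u v)

infixl 6 _─_
_─_ : ∀ {n} → Graph n → EdgeSet n → Graph n
G ─ F = record
  { Adj        = λ u v → Adj G u v × ¬ Adj F u v
  ; adj?       = λ u v → adj? G u v ×-dec ¬? (adj? F u v)
  ; adj-sym    = λ (g , ¬f) → adj-sym G g , λ f → ¬f (adj-sym F f)
  ; adj-irrefl = λ u (g , _) → adj-irrefl G u g
  }

Connected : ∀ {n} → Graph n → Set
Connected G = ∀ u v → Star (Adj G) u v

InducedConnected : ∀ {n} → Graph n → Subset n → Set
InducedConnected G X =
  ∀ {u v} → u ∈ X → v ∈ X → Star (λ a b → a ∈ X × b ∈ X × Adj G a b) u v

IsComponent : ∀ {n} → Graph n → Subset n → Set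
IsComponent G C = ∃[ v ] (∀ u → u ∈ C ⇔ Star (Adj G) v u)

EdgeConnected : ∀ {n} → ℕ → Graph n → Set₁
EdgeConnected {n} k G =
  1 < n × (∀ (F : EdgeSet n) → F ⊆ᴱ G → size F < k → Connected (G ─ F))

boundary : ∀ {n} → Graph n → Subset n → ℕ
boundary {n} G X =
  ∑[ u < n ] ∑[ v < n ] 𝟙 ((u ∈? X) ×-dec (¬? (v ∈? X) ×-dec adj? G u v))

IsMinimum : ∀ {a p} {A : Set a} → (A → Set p) → (A → ℕ) → ℕ → Set _
IsMinimum {A = A} P f ℓ = (Σ[ x ∈ A ] (P x × f x ≡ ℓ)) × (∀ x → P x → ℓ ≤ f x)

IsExtraEdgeCut : ∀ {n} → ℕ → Graph n → EdgeSet n → Set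
IsExtraEdgeCut h G F =
  F ⊆ᴱ G × ¬ Connected (G ─ F) × (∀ C → IsComponent (G ─ F) C → h < ∣ C ∣)

-- λ^(h)(G) and ξ_h(G) are partial: the minima range over possibly empty
-- families.  They are therefore given as the relations "λ^(h)(G) = ℓ" and
-- "ξ_h(G) = ℓ", with boundary G X in the role of d_G(X).  The former is only
-- used for connected G; it holds for some ℓ iff G is λ^(h)-connected.

Isλ : ∀ {n} → ℕ → Graph n → ℕ → Set₁
Isλ h G ℓ = IsMinimum (IsExtraEdgeCut h G) size ℓ

Isξ : ∀ {n} → ℕ → Graph n → ℕ → Set
Isξ h G ℓ = IsMinimum (λ X → ∣ X ∣ ≡ suc h × InducedConnected G X) (boundary G) ℓ

IsλCut : ∀ {n} → ℕ → Graph n → EdgeSet n → Set₁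
IsλCut h G F = IsExtraEdgeCut h G F × Isλ h G (size F)

λ-Optimal : ∀ {n} → ℕ → Graph n → Set₁
λ-Optimal h G = Connected G × ∃[ ℓ ] (Isλ h G ℓ × Isξ h G ℓ)

Super-λ : ∀ {n} → ℕ → Graph n → Set₁
Super-λ h G =
  λ-Optimal h G ×
  (∀ F → IsλCut h G F → ∃[ C ] (IsComponent (G ─ F) C × ∣ C ∣ ≡ suc h))

Super-λ′ : ∀ {n} → Graph n → Set₁
Super-λ′ = Super-λ 1

Super-λ″ : ∀ {n} → Graph n → Set₁
Super-λ″ = Super-λ 2

Super-λ′-Upto : ∀ {n} → Graph n → ℕ → Set₁
Super-λ′-Upto G r = ∀ F → F ⊆ᴱ G → size F ≤ r → Super-λ′ (G ─ F)

-- "ρ′(G) = r", including that G itself is super-λ′.  As for the minima above,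
-- the maximum is given relationally.

Persistence : ∀ {n} → Graph n → ℕ → Set₁
Persistence G r =
  Super-λ′ G × Super-λ′-Upto G r × (∀ s → Super-λ′-Upto G s → s ≤ r)

next : ∀ {m} → Fin m → Fin m
next {suc m} i = suc (toℕ i) mod suc m

next≢ : ∀ {m} → 3 ≤ m → (i : Fin m) → next i ≢ i
next≢ {suc m} (s≤s (s≤s _)) i eq = absurd (m≤n⇒m<n∨m≡n (toℕ<n i))
  where
  wrap : suc (toℕ i) % suc m ≡ toℕ i
  wrap = trans (sym (toℕ-fromℕ< (m%n<n (suc (toℕ i)) (suc m)))) (cong toℕ eq)

  absurd : ¬ (suc (toℕ i) < suc m ⊎ suc (toℕ i) ≡ suc m)
  absurd (inj₁ lt)   = 1+n≢n (trans (sym (m<n⇒m%n≡m lt)) wrap)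
  absurd (inj₂ last) with trans (sym last)
    (cong suc (trans (sym wrap) (trans (cong (_% suc m) last) (n%n≡0 (suc m)))))
  ... | ()

-- The graph G(G₀, …, G_{m-1}; ℳ).  The vertex of Fin (m * n) with
-- remQuot n p ≡ (i , u) is the vertex u of the i-th graph, and the permutation
-- M i is the matching between the i-th and the (i+1 mod m)-th graph, joining
-- u in the former to M i ⟨$⟩ʳ u in the latter.

module _ {m n : ℕ} (G : Fin m → Graph n) (M : Fin m → Permutation′ n) where

  Matched : Rel (Fin m × Fin n) 0ℓ
  Matched (i , u) (j , v) = j ≡ next i × v ≡ M i ⟨$⟩ʳ u

  CycAdj : Rel (Fin m × Fin n) 0ℓ
  CycAdj (i , u) (j , v) =
    (i ≡ j × Adj (G i) u v) ⊎ (Matched (i , u) (j , v) ⊎ Matched (j , v) (i , u))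

  cycAdj? : Decidable CycAdj
  cycAdj? (i , u) (j , v) =
    ((i ≟ᶠ j) ×-dec adj? (G i) u v) ⊎-dec
    (((j ≟ᶠ next i) ×-dec (v ≟ᶠ M i ⟨$⟩ʳ u)) ⊎-dec
     ((i ≟ᶠ next j) ×-dec (u ≟ᶠ M j ⟨$⟩ʳ v)))

  cycAdj-sym : Symmetric CycAdj
  cycAdj-sym (inj₁ (refl , a))  = inj₁ (refl , adj-sym (G _) a)
  cycAdj-sym (inj₂ (inj₁ e))    = inj₂ (inj₂ e)
  cycAdj-sym (inj₂ (inj₂ e))    = inj₂ (inj₁ e)

  cycAdj-irrefl : 3 ≤ m → ∀ p → ¬ CycAdj p p
  cycAdj-irrefl _   (i , u) (inj₁ (_ , a))        = adj-irrefl (G i) u a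
  cycAdj-irrefl 3≤m (i , u) (inj₂ (inj₁ (e , _))) = next≢ 3≤m i (sym e)
  cycAdj-irrefl 3≤m (i , u) (inj₂ (inj₂ (e , _))) = next≢ 3≤m i (sym e)

cyclicJoin : ∀ {m n} → 3 ≤ m → (Fin m → Graph n) → (Fin m → Permutation′ n) →
             Graph (m * n)
cyclicJoin {m} {n} 3≤m G M = record
  { Adj        = λ p q → CycAdj G M (remQuot n p) (remQuot n q)
  ; adj?       = λ p q → cycAdj? G M (remQuot n p) (remQuot n q)
  ; adj-sym    = cycAdj-sym G M
  ; adj-irrefl = λ p → cycAdj-irrefl G M 3≤m (remQuot n p)
  }

{-# OPTIONS --safe #-}

-- Write Γ for the join; it is (k+2)-regular and, since m ≥ 4, triangle-free.
-- Everything rests on d(X) ≥ 3k+3 whenever X and its complement have at least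
-- four vertices.  If some layer avoids X and another lies inside X, the two arcs
-- of the cycle between them carry at least 2n matching edges of the boundary.
-- If every layer is cut by X, edge-connectivity gives mk ≥ 4k.  Otherwise, after
-- complementing, X meets P layers and misses one, so d(X) ≥ Pk + 2 max ∣Xᵢ∣,
-- which suffices once ∣X∣ > 2k; for ∣X∣ ≤ 2k Mantel's theorem suffices.  Sets of
-- one, two and three vertices have boundary at least k+2, 2k+2 and 3k+2, again by
-- Mantel's theorem.
--
-- A 2-extra edge-cut contains the boundary of a component, so it has at least
-- 3k+2 edges, and more unless some component has three vertices.  For a subgraph
-- H = Γ - F with ∣F∣ ≤ k+1, boundaries drop by at most k+1, and the same argument
-- compares components of at least three vertices with an edge uv of H that
-- minimises deg u + deg v.  Deleting the k+2 edges at a vertex disconnects Γ.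

module Submission where

open import Defs
open import Data.Fin.Base using (Fin; zero; suc; toℕ; fromℕ; fromℕ<; inject₁; combine; remQuot; _↑ˡ_; _↑ʳ_)
open import Data.Fin.Permutation using (Permutation′; permutation; _⟨$⟩ʳ_; _⟨$⟩ˡ_; inverseˡ; inverseʳ)
open import Data.Fin.Properties using (any?; toℕ-injective; toℕ<n; toℕ-fromℕ; toℕ-fromℕ<; toℕ-inject₁; remQuot-combine; combine-remQuot)
  renaming (_≟_ to _≟ᶠ_; _<?_ to _<?ᶠ_; <-cmp to <-cmpᶠ)
open import Data.Fin.Subset using (Subset; _∈_; _∉_; ∣_∣; ∁; _∪_; ⁅_⁆; ⊥; inside; outside)
open import Data.Fin.Subset.Properties
open import Data.Nat.Base using (ℕ; zero; suc; _+_; _*_; _%_; _/_; _≤_; _<_; z≤n; s≤s; s≤s⁻¹; ⌈_/2⌉)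
open import Data.Nat.DivMod using (_mod_; m≡m%n+[m/n]*n; m%n<n; m<n⇒m%n≡m; n%n≡0)
open import Data.Nat.Properties
open import Data.Nat.Tactic.RingSolver using (solve-∀)
open import Data.Product.Base using (∃-syntax; _×_; _,_; proj₁; proj₂; uncurry)
open import Data.Sum.Base using (_⊎_; inj₁; inj₂; [_,_]′)
open import Data.Vec.Base using ([]; _∷_; there; lookup; tabulate)
open import Data.Vec.Properties using (lookup∘tabulate; []=⇒lookup; lookup⇒[]=)
open import Function.Base using (_∘_; id)
open import Function.Bundles using (_⇔_; mk⇔; Equivalence)
open import Relation.Binary.Construct.Closure.ReflexiveTransitive as Star using (Star; ε; _◅_; _◅◅_)
open import Relation.Binary.Definitions using (tri<; tri≈; tri>)
open import Relation.Binary.PropositionalEquality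
  using (_≡_; _≢_; refl; sym; trans; cong; cong₂; subst; subst₂; module ≡-Reasoning)
open import Relation.Nullary.Decidable using (Dec; yes; no; ¬?; _×-dec_; _⊎-dec_; map′)
open import Relation.Nullary.Negation using (¬_; contradiction)

open import Algebra.Properties.CommutativeSemigroup *-commutativeSemigroup using (x∙yz≈y∙xz)
open import Algebra.Properties.Semiring.Sum +-*-semiring
  using (sum; sum-cong-≗; ∑-distrib-+; ∑-comm; *-distribˡ-sum; *-distribʳ-sum; sum-replicate-zero; ∑-permute)

-- The constant 3k+3 leaves one unit of room in two places. It exceeds 3k+2, the boundary of a path
-- on three vertices, which decides super-λ″. Reduced by a loss of k+1 it becomes 2k+2, the boundary
-- of an edge in Γ itself, so for a subgraph `H` the comparison seems to end in a tie. It does not: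
-- if `H` misses an edge at `x`, then `x` still has a neighbour in `H`, the two degrees are at most
-- k+1 and k+2, and the lightest edge of `H` has boundary at most 2k+1; if `H` misses no edge,
-- nothing was lost. The obstacle in `H` is low degree. Degrees may fall to 1, so counting
-- neighbours no longer shows that cutting off an edge leaves no isolated vertex, nor that enlarging
-- an edge to a path enlarges the boundary. The substitute: two vertices nonadjacent in Γ have a
-- joint boundary of 2k+4, hence degree sum at least k+3 in `H`, so they cannot both have degree at
-- most 2. About `H` only the loss of boundaries is assumed, not a deleted edge set, so that Γ
-- itself is covered by the same argument.

private variable
  m n : ℕ

-- Finite sums of natural numbers

infixl 10 ∑
syntax ∑ (λ i → x) = ∑[ i ] x

-- Sums are opaque so that unification recovers the summand.

opaque

  ∑ : (Fin n → ℕ) → ℕ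
  ∑ f = sum f

  ∑≡sum : (f : Fin n → ℕ) → ∑ f ≡ sum f
  ∑≡sum f = refl

  ∑-suc : (f : Fin (suc n) → ℕ) → ∑ f ≡ f zero + ∑ (λ i → f (suc i))
  ∑-suc f = refl

  ∑-cong : {f g : Fin n → ℕ} → (∀ i → f i ≡ g i) → ∑ f ≡ ∑ g
  ∑-cong f≡g = sum-cong-≗ f≡g

  ∑-mono : {f g : Fin n → ℕ} → (∀ i → f i ≤ g i) → ∑ f ≤ ∑ g
  ∑-mono {zero}  f≤g = z≤n
  ∑-mono {suc n} f≤g = +-mono-≤ (f≤g zero) (∑-mono (λ i → f≤g (suc i)))

  ∑-zero : {f : Fin n → ℕ} → (∀ i → f i ≡ 0) → ∑ f ≡ 0
  ∑-zero {n} f≡0 = trans (sum-cong-≗ f≡0) (sum-replicate-zero n)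

  term≤∑ : (f : Fin n → ℕ) (i : Fin n) → f i ≤ ∑ f
  term≤∑ f zero    = m≤m+n (f zero) _
  term≤∑ f (suc i) = ≤-trans (term≤∑ (λ j → f (suc j)) i) (m≤n+m _ (f zero))

  ∑-+ : (f g : Fin n → ℕ) → ∑ (λ i → f i + g i) ≡ ∑ f + ∑ g
  ∑-+ f g = ∑-distrib-+ f g

  ∑-*ˡ : (a : ℕ) (f : Fin n → ℕ) → ∑ (λ i → a * f i) ≡ a * ∑ f
  ∑-*ˡ a f = sym (*-distribˡ-sum a f)

  ∑-*ʳ : (a : ℕ) (f : Fin n → ℕ) → ∑ (λ i → f i * a) ≡ ∑ f * a
  ∑-*ʳ a f = sym (*-distribʳ-sum a f)

  ∑-swap : (f : Fin m → Fin n → ℕ) →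
           ∑ (λ i → ∑ (λ j → f i j)) ≡ ∑ (λ j → ∑ (λ i → f i j))
  ∑-swap f = ∑-comm f

  ∑-permutation : (f : Fin n → ℕ) (π : Permutation′ n) → ∑ f ≡ ∑ (λ i → f (π ⟨$⟩ʳ i))
  ∑-permutation f π = ∑-permute f π

argmax : ∀ {n} (f : Fin (suc n) → ℕ) → ∃[ i ] (∀ j → f j ≤ f i)
argmax {zero}  f = zero , λ { zero → ≤-refl }
argmax {suc n} f with argmax (λ i → f (suc i))
... | i , max with ≤-total (f zero) (f (suc i))
...   | inj₁ le = suc i , λ { zero → le ; (suc j) → max j }
...   | inj₂ ge = zero , λ { zero → ≤-refl ; (suc j) → ≤-trans (max j) ge }

-- Indicators of decidable propositions

𝟙-× : {P Q : Set} (P? : Dec P) (Q? : Dec Q) → 𝟙 (P? ×-dec Q?) ≡ 𝟙 P? * 𝟙 Q?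
𝟙-× (yes _) (yes _) = refl
𝟙-× (yes _) (no _)  = refl
𝟙-× (no _)  _       = refl

𝟙-yes : {P : Set} (P? : Dec P) → P → 𝟙 P? ≡ 1
𝟙-yes (yes _) _ = refl
𝟙-yes (no ¬p) p = contradiction p ¬p

𝟙-no : {P : Set} (P? : Dec P) → ¬ P → 𝟙 P? ≡ 0
𝟙-no (yes p) ¬p = contradiction p ¬p
𝟙-no (no _)  _  = refl

𝟙-mono : {P Q : Set} (P? : Dec P) (Q? : Dec Q) → (P → Q) → 𝟙 P? ≤ 𝟙 Q?
𝟙-mono (no _)  Q? f = z≤n
𝟙-mono (yes p) Q? f = ≤-reflexive (sym (𝟙-yes Q? (f p)))

𝟙-cong : {P Q : Set} (P? : Dec P) (Q? : Dec Q) → (P → Q) → (Q → P) → 𝟙 P? ≡ 𝟙 Q?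
𝟙-cong P? Q? f g = ≤-antisym (𝟙-mono P? Q? f) (𝟙-mono Q? P? g)

𝟙-¬ : {P : Set} (P? : Dec P) → 𝟙 P? + 𝟙 (¬? P?) ≡ 1
𝟙-¬ (yes _) = refl
𝟙-¬ (no _)  = refl

𝟙≤1 : {P : Set} (P? : Dec P) → 𝟙 P? ≤ 1
𝟙≤1 (yes _) = ≤-refl
𝟙≤1 (no _)  = z≤n

𝟙-⊎ : {P Q : Set} (P? : Dec P) (Q? : Dec Q) → ¬ (P × Q) → 𝟙 (P? ⊎-dec Q?) ≡ 𝟙 P? + 𝟙 Q?
𝟙-⊎ (yes p) (yes q) ¬pq = contradiction (p , q) ¬pq
𝟙-⊎ (yes _) (no _)  _   = refl
𝟙-⊎ (no _)  (yes _) _   = refl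
𝟙-⊎ (no _)  (no _)  _   = refl

∑-select : (f : Fin n → ℕ) (i : Fin n) → ∑[ j ] (f j * 𝟙 (j ≟ᶠ i)) ≡ f i
∑-select {suc n} f zero    = trans (∑-suc _) (trans
  (cong₂ _+_ (*-identityʳ (f zero)) (∑-zero (λ j → *-zeroʳ (f (suc j)))))
  (+-identityʳ (f zero)))
∑-select {suc n} f (suc i) = trans (∑-suc _) (trans
  (cong₂ _+_ (*-zeroʳ (f zero)) (∑-cong (λ j → cong (f (suc j) *_)
    (𝟙-cong (suc j ≟ᶠ suc i) (j ≟ᶠ i) (λ { refl → refl }) (cong suc)))))
  (∑-select (λ j → f (suc j)) i))

-- Characteristic functions of vertex sets

χ : Subset n → Fin n → ℕ
χ X u = 𝟙 (u ∈? X)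

∑χ : (X : Subset n) → ∑[ u ] χ X u ≡ ∣ X ∣
∑χ []            = ∑-zero {f = χ []} (λ ())
∑χ (inside  ∷ X) = trans (∑-suc (χ (inside ∷ X))) (cong suc (trans (∑-cong (λ u →
  𝟙-cong (suc u ∈? (inside ∷ X)) (u ∈? X) drop-there there)) (∑χ X)))
∑χ (outside ∷ X) = trans (∑-suc (χ (outside ∷ X))) (trans (∑-cong (λ u →
  𝟙-cong (suc u ∈? (outside ∷ X)) (u ∈? X) drop-there there)) (∑χ X))

χ-∁ : (X : Subset n) (u : Fin n) → 𝟙 (¬? (u ∈? X)) ≡ χ (∁ X) u
χ-∁ X u = 𝟙-cong (¬? (u ∈? X)) (u ∈? ∁ X) x∉p⇒x∈∁p x∈∁p⇒x∉p

χ+χ∁ : (X : Subset n) (u : Fin n) → χ X u + χ (∁ X) u ≡ 1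
χ+χ∁ X u = trans (cong (χ X u +_) (sym (χ-∁ X u))) (𝟙-¬ (u ∈? X))

-- Adjacency as a bilinear form

opaque

  -- The adjacency matrix applied to a weight, followed by its bilinear form `pairs`. Weights in
  -- place of subsets let 1 = `χ X` + `χ (∁ X)` and the splitting of `χ` over a disjoint union be
  -- used by linearity.
  nbr : Graph n → (Fin n → ℕ) → Fin n → ℕ
  nbr G g u = ∑[ v ] (g v * 𝟙 (adj? G u v))

  pairs : Graph n → (Fin n → ℕ) → (Fin n → ℕ) → ℕ
  pairs G f g = ∑[ u ] (f u * nbr G g u)

  nbr-def : (G : Graph n) (g : Fin n → ℕ) (u : Fin n) →
            nbr G g u ≡ ∑[ v ] (g v * 𝟙 (adj? G u v))
  nbr-def G g u = refl

  pairs-def : (G : Graph n) (f g : Fin n → ℕ) → pairs G f g ≡ ∑[ u ] (f u * nbr G g u)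
  pairs-def G f g = refl

  nbr-cong : (G : Graph n) {g g′ : Fin n → ℕ} → (∀ v → g v ≡ g′ v) → ∀ u → nbr G g u ≡ nbr G g′ u
  nbr-cong G eq u = ∑-cong (λ v → cong (_* 𝟙 (adj? G u v)) (eq v))

  nbr-+ : (G : Graph n) (g g′ : Fin n → ℕ) → ∀ u →
          nbr G (λ v → g v + g′ v) u ≡ nbr G g u + nbr G g′ u
  nbr-+ G g g′ u = trans (∑-cong (λ v → *-distribʳ-+ (𝟙 (adj? G u v)) (g v) (g′ v)))
    (∑-+ (λ v → g v * 𝟙 (adj? G u v)) _)

  pairs-cong : (G : Graph n) {f f′ g g′ : Fin n → ℕ} →
               (∀ v → f v ≡ f′ v) → (∀ v → g v ≡ g′ v) → pairs G f g ≡ pairs G f′ g′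
  pairs-cong G eq eq′ = ∑-cong (λ u → cong₂ _*_ (eq u) (nbr-cong G eq′ u))

  pairs-+ˡ : (G : Graph n) (f f′ g : Fin n → ℕ) →
             pairs G (λ v → f v + f′ v) g ≡ pairs G f g + pairs G f′ g
  pairs-+ˡ G f f′ g = trans (∑-cong (λ u → *-distribʳ-+ (nbr G g u) (f u) (f′ u)))
    (∑-+ (λ u → f u * nbr G g u) _)

  pairs-+ʳ : (G : Graph n) (f g g′ : Fin n → ℕ) →
             pairs G f (λ v → g v + g′ v) ≡ pairs G f g + pairs G f g′
  pairs-+ʳ G f g g′ = trans (∑-cong (λ u → trans (cong (f u *_) (nbr-+ G g g′ u))
    (*-distribˡ-+ (f u) (nbr G g u) (nbr G g′ u)))) (∑-+ (λ u → f u * nbr G g u) _)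

  pairs-comm : (G : Graph n) (f g : Fin n → ℕ) → pairs G f g ≡ pairs G g f
  pairs-comm G f g = begin
    ∑[ u ] (f u * nbr G g u)
      ≡⟨ ∑-cong (λ u → sym (∑-*ˡ (f u) _)) ⟩
    ∑[ u ] (∑[ v ] (f u * (g v * 𝟙 (adj? G u v))))
      ≡⟨ ∑-swap _ ⟩
    ∑[ v ] (∑[ u ] (f u * (g v * 𝟙 (adj? G u v))))
      ≡⟨ ∑-cong (λ v → ∑-cong (λ u → trans (cong (λ t → f u * (g v * t))
           (𝟙-cong (adj? G u v) (adj? G v u) (adj-sym G) (adj-sym G)))
           (x∙yz≈y∙xz (f u) (g v) _))) ⟩
    ∑[ v ] (∑[ u ] (g v * (f u * 𝟙 (adj? G v u))))
      ≡⟨ ∑-cong (λ v → ∑-*ˡ (g v) _) ⟩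
    ∑[ v ] (g v * nbr G f v) ∎
    where
    open ≡-Reasoning

  nbr-one : (G : Graph n) (u : Fin n) → nbr G (λ _ → 1) u ≡ degree G u
  nbr-one G u = trans (∑-cong (λ v → *-identityˡ (𝟙 (adj? G u v))))
    (∑≡sum (λ v → 𝟙 (adj? G u v)))

  boundary≡pairs : (G : Graph n) (X : Subset n) → boundary G X ≡ pairs G (χ X) (χ (∁ X))
  boundary≡pairs G X = sym (trans (∑≡sum _) (sum-cong-≗ (λ u →
    trans (sym (∑-*ˡ (χ X u) (λ v → χ (∁ X) v * 𝟙 (adj? G u v))))
      (trans (∑≡sum _) (sum-cong-≗ (λ v → sym (trans
        (𝟙-× (u ∈? X) (¬? (v ∈? X) ×-dec adj? G u v))
        (cong (χ X u *_) (trans (𝟙-× (¬? (v ∈? X)) (adj? G u v))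
          (cong (_* 𝟙 (adj? G u v)) (χ-∁ X v)))))))))))

χ-∁-∁ : (X : Subset n) (u : Fin n) → χ (∁ (∁ X)) u ≡ χ X u
χ-∁-∁ X u = +-cancelˡ-≡ (χ (∁ X) u) _ _
  (trans (χ+χ∁ (∁ X) u) (trans (sym (χ+χ∁ X u)) (+-comm (χ X u) _)))

module _ (G : Graph n) (X : Subset n) where

  open ≡-Reasoning

  boundary-∁ : boundary G (∁ X) ≡ boundary G X
  boundary-∁ = begin
    boundary G (∁ X)
      ≡⟨ boundary≡pairs G (∁ X) ⟩
    pairs G (χ (∁ X)) (χ (∁ (∁ X)))
      ≡⟨ pairs-cong G {χ (∁ X)} {χ (∁ X)} {χ (∁ (∁ X))} (λ _ → refl) (χ-∁-∁ X) ⟩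
    pairs G (χ (∁ X)) (χ X)
      ≡⟨ pairs-comm G (χ (∁ X)) (χ X) ⟩
    pairs G (χ X) (χ (∁ X))
      ≡⟨ boundary≡pairs G X ⟨
    boundary G X ∎

  -- The constant weight 1 splits as `χ (∁ X)` plus `χ X`. The last term counts every edge inside
  -- `X` twice.
  degree-sum : ∑[ u ] (χ X u * degree G u) ≡ boundary G X + pairs G (χ X) (χ X)
  degree-sum = begin
    ∑[ u ] (χ X u * degree G u)
      ≡⟨ ∑-cong (λ u → cong (χ X u *_) (nbr-one G u)) ⟨
    ∑[ u ] (χ X u * nbr G (λ _ → 1) u)
      ≡⟨ pairs-def G (χ X) (λ _ → 1) ⟨
    pairs G (χ X) (λ _ → 1)
      ≡⟨ pairs-cong G {χ X} (λ _ → refl) (λ v → trans (+-comm (χ (∁ X) v) (χ X v)) (χ+χ∁ X v)) ⟨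
    pairs G (χ X) (λ v → χ (∁ X) v + χ X v)
      ≡⟨ pairs-+ʳ G (χ X) (χ (∁ X)) (χ X) ⟩
    pairs G (χ X) (χ (∁ X)) + pairs G (χ X) (χ X)
      ≡⟨ cong (_+ pairs G (χ X) (χ X)) (boundary≡pairs G X) ⟨
    boundary G X + pairs G (χ X) (χ X) ∎

-- Mantel's theorem

4*m*n≤[m+n]² : ∀ a b → 4 * (a * b) ≤ (a + b) * (a + b)
4*m*n≤[m+n]² a b with ≤-total a b
... | inj₁ a≤b with m≤n⇒∃[o]m+o≡n a≤b
-- The slack is the square of the difference `t`.
...   | t , refl = m+n≤o⇒m≤o (4 * (a * (a + t))) {t * t} (≤-reflexive (identity a t))
  where
  identity : ∀ a t → 4 * (a * (a + t)) + t * t ≡ (a + (a + t)) * (a + (a + t))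
  identity = solve-∀
4*m*n≤[m+n]² a b | inj₂ b≤a with m≤n⇒∃[o]m+o≡n b≤a
...   | t , refl = m+n≤o⇒m≤o (4 * ((b + t) * b)) {t * t} (≤-reflexive (identity b t))
  where
  identity : ∀ b t → 4 * ((b + t) * b) + t * t ≡ ((b + t) + b) * ((b + t) + b)
  identity = solve-∀

-- Mantel's bound on the number of edges inside X: for a vertex u of maximum
-- degree Δ in G[X], the neighbours of u in X have inner degree at most ∣X∣ - Δ,
-- because a common neighbour with u would close a triangle.

mantel : (G : Graph n) → TriangleFree G → (X : Subset n) →
         2 * pairs G (χ X) (χ X) ≤ ∣ X ∣ * ∣ X ∣
mantel {zero}  G tf [] = ≤-reflexive (cong (2 *_) (trans (pairs-def G _ _) (∑-zero {f = λ u → χ [] u * nbr G (χ []) u} (λ ()))))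
mantel {suc n} G tf X with argmax (λ u → χ X u * nbr G (χ X) u)
... | u , max = begin
  2 * pairs G (χ X) (χ X)  ≤⟨ *-monoʳ-≤ 2 inner≤ ⟩
  2 * (Δ * s + s * Δ)      ≡⟨ double Δ s ⟩
  4 * (Δ * s)              ≤⟨ 4*m*n≤[m+n]² Δ s ⟩
  (Δ + s) * (Δ + s)        ≡⟨ cong₂ _*_ split split ⟩
  ∣ X ∣ * ∣ X ∣            ∎
  where
  open ≤-Reasoning
  double : ∀ a b → 2 * (a * b + b * a) ≡ 4 * (a * b)
  double = solve-∀
  α ᾱ : Fin (suc n) → ℕ
  α v = 𝟙 (adj? G u v)
  ᾱ v = 𝟙 (¬? (adj? G u v))
  Δ s : ℕ
  Δ = ∑[ v ] (χ X v * α v)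
  s = ∑[ v ] (χ X v * ᾱ v)
  split : Δ + s ≡ ∣ X ∣
  split = trans (sym (∑-+ (λ v → χ X v * α v) (λ v → χ X v * ᾱ v))) (trans (∑-cong (λ v →
    trans (sym (*-distribˡ-+ (χ X v) (α v) (ᾱ v)))
      (trans (cong (χ X v *_) (𝟙-¬ (adj? G u v))) (*-identityʳ _)))) (∑χ X))
  inner : ∀ w → χ X w * nbr G (χ X) w ≤ (χ X w * α w) * s + (χ X w * ᾱ w) * Δ
  inner w = by-cases (w ∈? X) (adj? G u w) (max w)
    where
    by-cases : (w∈X : Dec (w ∈ X)) (uw : Dec (Adj G u w)) →
               𝟙 w∈X * nbr G (χ X) w ≤ χ X u * nbr G (χ X) u →
               𝟙 w∈X * nbr G (χ X) w ≤ (𝟙 w∈X * 𝟙 uw) * s + (𝟙 w∈X * 𝟙 (¬? uw)) * Δ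
    by-cases (no _)  _        _    = z≤n
    by-cases (yes _) (yes uw) _    = begin
      1 * nbr G (χ X) w              ≡⟨ *-identityˡ (nbr G (χ X) w) ⟩
      nbr G (χ X) w                  ≡⟨ nbr-def G (χ X) w ⟩
      ∑[ v ] (χ X v * 𝟙 (adj? G w v)) ≤⟨ ∑-mono (λ v → *-monoʳ-≤ (χ X v)
        (𝟙-mono (adj? G w v) (¬? (adj? G u v)) (λ wv uv → tf u w v (uw , wv , uv)))) ⟩
      s                              ≡⟨ trans (sym (*-identityˡ s)) (sym (+-identityʳ (1 * s))) ⟩
      1 * s + 0 * Δ                  ∎
    -- A non-neighbour of `u` is bounded by the maximum itself. If that maximum is 0, `u` may lie
    -- outside `X`; dropping the factor `χ X u` only enlarges the bound.
    by-cases (yes _) (no _)   max₀ = begin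
      1 * nbr G (χ X) w       ≤⟨ max₀ ⟩
      χ X u * nbr G (χ X) u   ≤⟨ *-monoˡ-≤ (nbr G (χ X) u) (𝟙≤1 (u ∈? X)) ⟩
      1 * nbr G (χ X) u       ≡⟨ cong (1 *_) (nbr-def G (χ X) u) ⟩
      1 * Δ                   ∎
  inner≤ : pairs G (χ X) (χ X) ≤ Δ * s + s * Δ
  inner≤ = ≤-trans (≤-reflexive (pairs-def G (χ X) (χ X))) (≤-trans (∑-mono inner) (≤-reflexive (trans
    (∑-+ (λ w → (χ X w * α w) * s) (λ w → (χ X w * ᾱ w) * Δ))
    (cong₂ _+_ (∑-*ʳ s _) (∑-*ʳ Δ _)))))

-- Sets with few vertices

χ-single : (z v : Fin n) → χ ⁅ z ⁆ v ≡ 𝟙 (v ≟ᶠ z)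
χ-single z v = 𝟙-cong (v ∈? ⁅ z ⁆) (v ≟ᶠ z) (x∈⁅y⁆⇒x≡y z) (λ { refl → x∈⁅x⁆ z })

∑-χ-single : (z : Fin n) (f : Fin n → ℕ) → ∑[ v ] (χ ⁅ z ⁆ v * f v) ≡ f z
∑-χ-single z f = trans (∑-cong (λ v → trans (cong (_* f v) (χ-single z v)) (*-comm (𝟙 (v ≟ᶠ z)) (f v))))
  (∑-select f z)

χ-insert : {z : Fin n} {Y : Subset n} → z ∉ Y → ∀ v → χ (⁅ z ⁆ ∪ Y) v ≡ χ ⁅ z ⁆ v + χ Y v
χ-insert {z = z} {Y} z∉Y v = trans
  (𝟙-cong (v ∈? (⁅ z ⁆ ∪ Y)) ((v ∈? ⁅ z ⁆) ⊎-dec (v ∈? Y)) (x∈p∪q⁻ ⁅ z ⁆ Y) x∈p∪q⁺)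
  (𝟙-⊎ (v ∈? ⁅ z ⁆) (v ∈? Y) (λ { (p , q) → z∉Y (subst (_∈ Y) (x∈⁅y⁆⇒x≡y z p) q) }))

∣insert∣ : {z : Fin n} {Y : Subset n} → z ∉ Y → ∣ ⁅ z ⁆ ∪ Y ∣ ≡ suc ∣ Y ∣
∣insert∣ {z = z} {Y} z∉Y = begin
  ∣ ⁅ z ⁆ ∪ Y ∣                     ≡⟨ ∑χ (⁅ z ⁆ ∪ Y) ⟨
  ∑[ v ] χ (⁅ z ⁆ ∪ Y) v            ≡⟨ ∑-cong (χ-insert z∉Y) ⟩
  ∑[ v ] (χ ⁅ z ⁆ v + χ Y v)        ≡⟨ ∑-+ (χ ⁅ z ⁆) (χ Y) ⟩
  ∑[ v ] χ ⁅ z ⁆ v + ∑[ v ] χ Y v   ≡⟨ cong₂ _+_ (trans (∑χ ⁅ z ⁆) (∣⁅x⁆∣≡1 z)) (∑χ Y) ⟩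
  suc ∣ Y ∣                         ∎
  where open ≡-Reasoning

∣X∣≡0⇒X≡⊥ : (X : Subset n) → ∣ X ∣ ≡ 0 → X ≡ ⊥
∣X∣≡0⇒X≡⊥ []            _  = refl
∣X∣≡0⇒X≡⊥ (outside ∷ X) eq = cong (outside ∷_) (∣X∣≡0⇒X≡⊥ X eq)

pick : ∀ {j} (X : Subset n) → ∣ X ∣ ≡ suc j →
       ∃[ x ] ∃[ Y ] (x ∉ Y × ∣ Y ∣ ≡ j × X ≡ ⁅ x ⁆ ∪ Y)
pick (inside ∷ X) eq = zero , outside ∷ X , (λ ()) , suc-injective eq ,
  cong (inside ∷_) (sym (∪-identityˡ X))
pick (outside ∷ X) eq with pick X eq
... | x , Y , x∉Y , ∣Y∣ , refl = suc x , outside ∷ Y , (λ { (there p) → x∉Y p }) , ∣Y∣ , refl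

∣X∣≡1⇒single : (X : Subset n) → ∣ X ∣ ≡ 1 → ∃[ x ] X ≡ ⁅ x ⁆
∣X∣≡1⇒single X eq with pick X eq
... | x , Y , _ , ∣Y∣ , refl = x , trans (cong (⁅ x ⁆ ∪_) (∣X∣≡0⇒X≡⊥ Y ∣Y∣)) (∪-identityʳ ⁅ x ⁆)

⟦_⸴_⟧ : Fin n → Fin n → Subset n
⟦ x ⸴ y ⟧ = ⁅ x ⁆ ∪ ⁅ y ⁆

∣X∣≡2⇒pair : (X : Subset n) → ∣ X ∣ ≡ 2 → ∃[ x ] ∃[ y ] (x ≢ y × X ≡ ⟦ x ⸴ y ⟧)
∣X∣≡2⇒pair X eq with pick X eq
... | x , Y , x∉Y , ∣Y∣ , refl with ∣X∣≡1⇒single Y ∣Y∣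
... | y , refl = x , y , x∉⁅y⁆⇒x≢y x∉Y , refl

∈-pairˡ : (x y : Fin n) → x ∈ ⟦ x ⸴ y ⟧
∈-pairˡ x y = x∈p∪q⁺ (inj₁ (x∈⁅x⁆ x))

∈-pairʳ : (x y : Fin n) → y ∈ ⟦ x ⸴ y ⟧
∈-pairʳ x y = x∈p∪q⁺ (inj₂ (x∈⁅x⁆ y))

∈-pair⁻ : {x y z : Fin n} → z ∈ ⟦ x ⸴ y ⟧ → z ≡ x ⊎ z ≡ y
∈-pair⁻ {x = x} {y} p with x∈p∪q⁻ ⁅ x ⁆ ⁅ y ⁆ p
... | inj₁ q = inj₁ (x∈⁅y⁆⇒x≡y x q)
... | inj₂ q = inj₂ (x∈⁅y⁆⇒x≡y y q)

∉-pair : {x y z : Fin n} → z ≢ x → z ≢ y → z ∉ ⟦ x ⸴ y ⟧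
∉-pair {x = x} {y} z≢x z≢y p = [ z≢x , z≢y ]′ (∈-pair⁻ {x = x} {y} p)

∣pair∣ : {x y : Fin n} → x ≢ y → ∣ ⟦ x ⸴ y ⟧ ∣ ≡ 2
∣pair∣ {y = y} x≢y = trans (∣insert∣ (x≢y⇒x∉⁅y⁆ x≢y)) (cong suc (∣⁅x⁆∣≡1 y))

∈⇒∣X∣>0 : {x : Fin n} {X : Subset n} → x ∈ X → 1 ≤ ∣ X ∣
∈⇒∣X∣>0 {x = x} {X} x∈X = subst (_≤ ∣ X ∣) (∣⁅x⁆∣≡1 x)
  (p⊆q⇒∣p∣≤∣q∣ (λ p → subst (_∈ X) (sym (x∈⁅y⁆⇒x≡y x p)) x∈X))

pair⊆⇒2≤∣X∣ : {x y : Fin n} {X : Subset n} → x ≢ y → x ∈ X → y ∈ X → 2 ≤ ∣ X ∣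
pair⊆⇒2≤∣X∣ {x = x} {y} {X} x≢y x∈X y∈X = subst (_≤ ∣ X ∣) (∣pair∣ x≢y)
  (p⊆q⇒∣p∣≤∣q∣ {p = ⟦ x ⸴ y ⟧} {q = X}
    (λ p → [ (λ { refl → x∈X }) , (λ { refl → y∈X }) ]′ (∈-pair⁻ {x = x} {y} p)))

adj-≢ : (G : Graph n) {u v : Fin n} → Adj G u v → u ≢ v
adj-≢ G {u} uv refl = adj-irrefl G u uv

-- Neighbourhoods

nbr-single : (G : Graph n) (x y : Fin n) → nbr G (χ ⁅ y ⁆) x ≡ 𝟙 (adj? G x y)
nbr-single G x y = trans (nbr-def G (χ ⁅ y ⁆) x) (∑-χ-single y (λ v → 𝟙 (adj? G x v)))

nbr≤1 : (G : Graph n) (Y : Subset n) (u y : Fin n) →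
        (∀ v → v ∈ Y → Adj G u v → v ≡ y) → nbr G (χ Y) u ≤ 1
nbr≤1 G Y u y only = begin
  nbr G (χ Y) u                   ≡⟨ nbr-def G (χ Y) u ⟩
  ∑[ v ] (χ Y v * 𝟙 (adj? G u v)) ≤⟨ ∑-mono (λ v → ≤-trans
    (≤-reflexive (sym (𝟙-× (v ∈? Y) (adj? G u v))))
    (≤-trans (𝟙-mono ((v ∈? Y) ×-dec adj? G u v) (v ≟ᶠ y) (λ (p , q) → only v p q))
      (≤-reflexive (sym (*-identityˡ _))))) ⟩
  ∑[ v ] (1 * 𝟙 (v ≟ᶠ y))         ≡⟨ ∑-select (λ _ → 1) y ⟩
  1                               ∎
  where open ≤-Reasoning

degree≤∣Y∣ : (G : Graph n) (Y : Subset n) (u : Fin n) → (∀ v → Adj G u v → v ∈ Y) → degree G u ≤ ∣ Y ∣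
degree≤∣Y∣ G Y u N⊆Y = begin
  degree G u                ≡⟨ ∑≡sum (λ v → 𝟙 (adj? G u v)) ⟨
  ∑[ v ] 𝟙 (adj? G u v)     ≤⟨ ∑-mono (λ v → 𝟙-mono (adj? G u v) (v ∈? Y) (N⊆Y v)) ⟩
  ∑[ v ] χ Y v              ≡⟨ ∑χ Y ⟩
  ∣ Y ∣                     ∎
  where open ≤-Reasoning

neighbour-outside : (G : Graph n) (Y : Subset n) (u : Fin n) → ∣ Y ∣ < degree G u → ∃[ v ] (v ∉ Y × Adj G u v)
neighbour-outside G Y u lt with any? (λ v → ¬? (v ∈? Y) ×-dec adj? G u v)
... | yes found = found
... | no none   = contradiction (degree≤∣Y∣ G Y u N⊆Y) (<⇒≱ lt)
  where
  N⊆Y : ∀ v → Adj G u v → v ∈ Y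
  N⊆Y v uv with v ∈? Y
  ... | yes p = p
  ... | no ¬p = contradiction (v , ¬p , uv) none

-- Boundaries

module _ (G : Graph n) where

  private
    single-pairs : (z : Fin n) (g : Fin n → ℕ) → pairs G (χ ⁅ z ⁆) g ≡ nbr G g z
    single-pairs z g = trans (pairs-def G (χ ⁅ z ⁆) g) (∑-χ-single z (nbr G g))

    no-loop : (z : Fin n) → nbr G (χ ⁅ z ⁆) z ≡ 0
    no-loop z = trans (nbr-single G z z) (𝟙-no (adj? G z z) (adj-irrefl G z))

  boundary-single : (z : Fin n) → boundary G ⁅ z ⁆ ≡ degree G z
  boundary-single z = begin
    boundary G ⁅ z ⁆
      ≡⟨ +-identityʳ _ ⟨
    boundary G ⁅ z ⁆ + 0
      ≡⟨ cong (boundary G ⁅ z ⁆ +_) (trans (single-pairs z (χ ⁅ z ⁆)) (no-loop z)) ⟨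
    boundary G ⁅ z ⁆ + pairs G (χ ⁅ z ⁆) (χ ⁅ z ⁆)
      ≡⟨ degree-sum G ⁅ z ⁆ ⟨
    ∑[ u ] (χ ⁅ z ⁆ u * degree G u)
      ≡⟨ ∑-χ-single z (degree G) ⟩
    degree G z ∎
    where open ≡-Reasoning

  -- An edge from `z` to `Y` counts once in the boundary of `Y` and once in the degree of `z`, but
  -- no longer crosses the enlarged set; hence the factor 2. Comparing `degree-sum` for both sets
  -- avoids subtraction.
  boundary-insert : {z : Fin n} {Y : Subset n} → z ∉ Y →
                    boundary G Y + degree G z ≡ boundary G (⁅ z ⁆ ∪ Y) + 2 * nbr G (χ Y) z
  boundary-insert {z} {Y} z∉Y = cancel (boundary G Y) (degree G z) (boundary G Z) N (pairs G (χ Y) (χ Y))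
    (begin
      degree G z + (boundary G Y + pairs G (χ Y) (χ Y))
        ≡⟨ cong₂ _+_ (∑-χ-single z (degree G)) (degree-sum G Y) ⟨
      ∑[ u ] (χ ⁅ z ⁆ u * degree G u) + ∑[ u ] (χ Y u * degree G u)
        ≡⟨ ∑-+ (λ u → χ ⁅ z ⁆ u * degree G u) (λ u → χ Y u * degree G u) ⟨
      ∑[ u ] (χ ⁅ z ⁆ u * degree G u + χ Y u * degree G u)
        ≡⟨ ∑-cong (λ u → trans (cong (_* degree G u) (χ-insert z∉Y u))
             (*-distribʳ-+ (degree G u) (χ ⁅ z ⁆ u) (χ Y u))) ⟨
      ∑[ u ] (χ Z u * degree G u)
        ≡⟨ degree-sum G Z ⟩
      boundary G Z + pairs G (χ Z) (χ Z)
        ≡⟨ cong (boundary G Z +_) pairs-Z ⟩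
      boundary G Z + (N + (N + pairs G (χ Y) (χ Y))) ∎)
    where
    open ≡-Reasoning
    Z = ⁅ z ⁆ ∪ Y
    N = nbr G (χ Y) z
    f : Fin n → ℕ
    f u = χ ⁅ z ⁆ u + χ Y u
    pairs-Z : pairs G (χ Z) (χ Z) ≡ N + (N + pairs G (χ Y) (χ Y))
    pairs-Z = begin
      pairs G (χ Z) (χ Z)
        ≡⟨ pairs-cong G (χ-insert z∉Y) (χ-insert z∉Y) ⟩
      pairs G f f
        ≡⟨ pairs-+ˡ G (χ ⁅ z ⁆) (χ Y) f ⟩
      pairs G (χ ⁅ z ⁆) f + pairs G (χ Y) f
        ≡⟨ cong₂ _+_ (single-pairs z f) (pairs-+ʳ G (χ Y) (χ ⁅ z ⁆) (χ Y)) ⟩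
      nbr G f z + (pairs G (χ Y) (χ ⁅ z ⁆) + pairs G (χ Y) (χ Y))
        ≡⟨ cong₂ _+_ (trans (nbr-+ G (χ ⁅ z ⁆) (χ Y) z) (cong (_+ N) (no-loop z)))
             (cong (_+ pairs G (χ Y) (χ Y)) (trans (pairs-comm G (χ Y) (χ ⁅ z ⁆)) (single-pairs z (χ Y)))) ⟩
      N + (N + pairs G (χ Y) (χ Y)) ∎
    cancel : ∀ bY d bZ N P → d + (bY + P) ≡ bZ + (N + (N + P)) → bY + d ≡ bZ + 2 * N
    cancel bY d bZ N P eq = +-cancelʳ-≡ P (bY + d) (bZ + 2 * N)
      (trans (lhs bY d P) (trans eq (rhs bZ N P)))
      where
      lhs : ∀ bY d P → (bY + d) + P ≡ d + (bY + P)
      lhs = solve-∀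
      rhs : ∀ bZ N P → bZ + (N + (N + P)) ≡ (bZ + 2 * N) + P
      rhs = solve-∀

  boundary-pair : {x y : Fin n} → x ≢ y →
                  degree G x + degree G y ≡ boundary G ⟦ x ⸴ y ⟧ + 2 * 𝟙 (adj? G x y)
  boundary-pair {x} {y} x≢y = begin
    degree G x + degree G y            ≡⟨ +-comm (degree G x) (degree G y) ⟩
    degree G y + degree G x            ≡⟨ cong (_+ degree G x) (boundary-single y) ⟨
    boundary G ⁅ y ⁆ + degree G x      ≡⟨ boundary-insert (x≢y⇒x∉⁅y⁆ x≢y) ⟩
    boundary G ⟦ x ⸴ y ⟧ + 2 * nbr G (χ ⁅ y ⁆) x
      ≡⟨ cong (λ t → boundary G ⟦ x ⸴ y ⟧ + 2 * t) (nbr-single G x y) ⟩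
    boundary G ⟦ x ⸴ y ⟧ + 2 * 𝟙 (adj? G x y) ∎
    where open ≡-Reasoning

  boundary-edge : {x y : Fin n} → Adj G x y → degree G x + degree G y ≡ boundary G ⟦ x ⸴ y ⟧ + 2
  boundary-edge {x} {y} xy = trans (boundary-pair (adj-≢ G xy))
    (cong (λ t → boundary G ⟦ x ⸴ y ⟧ + 2 * t) (𝟙-yes (adj? G x y) xy))

  boundary-nonadjacent : {x y : Fin n} → x ≢ y → ¬ Adj G x y →
                         degree G x + degree G y ≡ boundary G ⟦ x ⸴ y ⟧
  boundary-nonadjacent {x} {y} x≢y ¬xy = trans (boundary-pair x≢y)
    (trans (cong (λ t → boundary G ⟦ x ⸴ y ⟧ + 2 * t) (𝟙-no (adj? G x y) ¬xy)) (+-identityʳ _))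

-- Crossing edges

Crosses : Graph n → Subset n → Fin n → Fin n → Set
Crosses G X u v = u ∈ X × (v ∉ X × Adj G u v)

crosses? : (G : Graph n) (X : Subset n) (u v : Fin n) → Dec (Crosses G X u v)
crosses? G X u v = (u ∈? X) ×-dec (¬? (v ∈? X) ×-dec adj? G u v)

boundary≡∑∑ : (G : Graph n) (X : Subset n) → boundary G X ≡ ∑[ u ] (∑[ v ] 𝟙 (crosses? G X u v))
boundary≡∑∑ G X = sym (trans (∑-cong (λ u → ∑≡sum (λ v → 𝟙 (crosses? G X u v)))) (∑≡sum _))

boundary-mono : (G H : Graph n) (X : Subset n) →
                (∀ {u v} → Crosses G X u v → Adj H u v) → boundary G X ≤ boundary H X
boundary-mono G H X sub = begin
  boundary G X                            ≡⟨ boundary≡∑∑ G X ⟩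
  ∑[ u ] (∑[ v ] 𝟙 (crosses? G X u v))    ≤⟨ ∑-mono (λ u → ∑-mono (λ v →
    𝟙-mono (crosses? G X u v) (crosses? H X u v) (λ c → proj₁ c , proj₁ (proj₂ c) , sub c))) ⟩
  ∑[ u ] (∑[ v ] 𝟙 (crosses? H X u v))    ≡⟨ boundary≡∑∑ H X ⟨
  boundary H X                            ∎
  where open ≤-Reasoning

boundary-zero : (G : Graph n) (X : Subset n) → (∀ {u v} → ¬ Crosses G X u v) → boundary G X ≡ 0
boundary-zero G X none = trans (boundary≡∑∑ G X)
  (∑-zero (λ u → ∑-zero (λ v → 𝟙-no (crosses? G X u v) none)))

crosses⇒boundary>0 : (G : Graph n) (X : Subset n) {u v : Fin n} → Crosses G X u v → 1 ≤ boundary G X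
crosses⇒boundary>0 G X {u} {v} c = begin
  1                                       ≡⟨ 𝟙-yes (crosses? G X u v) c ⟨
  𝟙 (crosses? G X u v)                    ≤⟨ term≤∑ (λ v → 𝟙 (crosses? G X u v)) v ⟩
  ∑[ v ] 𝟙 (crosses? G X u v)             ≤⟨ term≤∑ (λ u → ∑[ v ] 𝟙 (crosses? G X u v)) u ⟩
  ∑[ u ] (∑[ v ] 𝟙 (crosses? G X u v))    ≡⟨ boundary≡∑∑ G X ⟨
  boundary G X                            ∎
  where open ≤-Reasoning

boundary-─ : (G F : Graph n) (X : Subset n) → boundary G X ≤ boundary (G ─ F) X + boundary F X
boundary-─ G F X = begin
  boundary G X
    ≡⟨ boundary≡∑∑ G X ⟩
  ∑[ u ] (∑[ v ] 𝟙 (crosses? G X u v))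
    ≤⟨ ∑-mono (λ u → ≤-trans (∑-mono (split u)) (≤-reflexive
         (∑-+ (λ v → 𝟙 (crosses? (G ─ F) X u v)) (λ v → 𝟙 (crosses? F X u v))))) ⟩
  ∑[ u ] (∑[ v ] 𝟙 (crosses? (G ─ F) X u v) + ∑[ v ] 𝟙 (crosses? F X u v))
    ≡⟨ ∑-+ (λ u → ∑[ v ] 𝟙 (crosses? (G ─ F) X u v)) (λ u → ∑[ v ] 𝟙 (crosses? F X u v)) ⟩
  ∑[ u ] (∑[ v ] 𝟙 (crosses? (G ─ F) X u v)) + ∑[ u ] (∑[ v ] 𝟙 (crosses? F X u v))
    ≡⟨ cong₂ _+_ (boundary≡∑∑ (G ─ F) X) (boundary≡∑∑ F X) ⟨
  boundary (G ─ F) X + boundary F X ∎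
  where
  open ≤-Reasoning
  split : ∀ u v → 𝟙 (crosses? G X u v) ≤ 𝟙 (crosses? (G ─ F) X u v) + 𝟙 (crosses? F X u v)
  split u v with u ∈? X | v ∈? X | adj? G u v | adj? F u v
  ... | no _  | _     | _     | _     = z≤n
  ... | yes _ | yes _ | _     | _     = z≤n
  ... | yes _ | no _  | no _  | _     = z≤n
  ... | yes _ | no _  | yes _ | yes _ = ≤-refl
  ... | yes _ | no _  | yes _ | no _  = ≤-refl

-- Paths and components

closed-star : (G : Graph n) (X : Subset n) → (∀ {u v} → ¬ Crosses G X u v) →
              ∀ {u v} → Star (Adj G) u v → u ∈ X → v ∈ X
closed-star G X closed ε        u∈X = u∈X
closed-star G X closed (_◅_ {j = w} uw path) u∈X with w ∈? X
... | yes w∈X = closed-star G X closed path w∈X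
... | no w∉X  = contradiction (u∈X , w∉X , uw) closed

star-crosses : (G : Graph n) (X : Subset n) → ∀ {u v} → Star (Adj G) u v → u ∈ X → v ∉ X → 1 ≤ boundary G X
star-crosses G X ε u∈X v∉X = contradiction u∈X v∉X
star-crosses G X (_◅_ {j = w} uw path) u∈X v∉X with w ∈? X
... | yes w∈X = star-crosses G X path w∈X v∉X
... | no w∉X  = crosses⇒boundary>0 G X (u∈X , w∉X , uw)

star-sym : (G : Graph n) → ∀ {u v} → Star (Adj G) u v → Star (Adj G) v u
star-sym G ε           = ε
star-sym G (uw ◅ path) = star-sym G path ◅◅ (adj-sym G uw ◅ ε)

-- Heads of crossing edges are added until no edge crosses. Each addition enlarges the set, so `n`
-- rounds suffice. This makes reachability decidable.
component : (G : Graph n) (v : Fin n) → ∃[ C ] (∀ u → u ∈ C ⇔ Star (Adj G) v u)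
component {n} G v = grow n ⁅ v ⁆ (x∈⁅x⁆ v)
    (λ u p → subst (Star (Adj G) v) (sym (x∈⁅y⁆⇒x≡y v p)) ε) (m≤n+m n ∣ ⁅ v ⁆ ∣)
  where
  grow : (fuel : ℕ) (X : Subset n) → v ∈ X → (∀ u → u ∈ X → Star (Adj G) v u) → n ≤ ∣ X ∣ + fuel →
         ∃[ C ] (∀ u → u ∈ C ⇔ Star (Adj G) v u)
  grow fuel X v∈X reach bound with any? (λ a → any? (λ b → crosses? G X a b))
  ... | no none = X , λ u → mk⇔ (reach u)
          (λ path → closed-star G X (λ c → none (_ , _ , c)) path v∈X)
  grow zero X v∈X reach bound | yes (a , b , a∈X , b∉X , ab) =
    contradiction (subst (_≤ n) (∣insert∣ b∉X) (∣p∣≤n (⁅ b ⁆ ∪ X)))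
      (<⇒≱ (s≤s (subst (n ≤_) (+-identityʳ ∣ X ∣) bound)))
  grow (suc fuel) X v∈X reach bound | yes (a , b , a∈X , b∉X , ab) =
    grow fuel (⁅ b ⁆ ∪ X) (x∈p∪q⁺ (inj₂ v∈X)) reach′
      (≤-trans bound (≤-reflexive (trans (+-suc ∣ X ∣ fuel) (cong (_+ fuel) (sym (∣insert∣ b∉X))))))
    where
    reach′ : ∀ u → u ∈ ⁅ b ⁆ ∪ X → Star (Adj G) v u
    reach′ u p with x∈p∪q⁻ ⁅ b ⁆ X p
    ... | inj₁ q = subst (Star (Adj G) v) (sym (x∈⁅y⁆⇒x≡y b q)) (reach a a∈X ◅◅ (ab ◅ ε))
    ... | inj₂ q = reach u q

component-closed : (G : Graph n) (C : Subset n) → IsComponent G C → ∀ {u v} → ¬ Crosses G C u v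
component-closed G C (r , iff) {u} {v} (u∈C , v∉C , uv) =
  v∉C (Equivalence.from (iff v) (Equivalence.to (iff u) u∈C ◅◅ (uv ◅ ε)))

component-star : (G : Graph n) (C : Subset n) → IsComponent G C → ∀ {u v} → u ∈ C → v ∈ C → Star (Adj G) u v
component-star G C (r , iff) {u} {v} u∈C v∈C =
  star-sym G (Equivalence.to (iff u) u∈C) ◅◅ Equivalence.to (iff v) v∈C

connected⁺ : (G : Graph n) → (∀ X u v → u ∈ X → v ∉ X → 1 ≤ boundary G X) → Connected G
connected⁺ G cut u v with component G u
... | C , iff with v ∈? C
...   | yes v∈C = Equivalence.to (iff v) v∈C
...   | no v∉C  = contradiction (≤-reflexive (boundary-zero G C (component-closed G C (u , iff))))
                    (<⇒≱ (cut C u v (Equivalence.from (iff u) ε) v∉C))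

-- Edge sets

-- `size` counts an edge at its smaller endpoint, `boundary` at its endpoint inside `X`. Folding a
-- sum over ordered pairs onto increasing pairs makes the two comparable.
∑∑-oriented : (w : Fin n → Fin n → ℕ) → (∀ u → w u u ≡ 0) →
              ∑[ u ] (∑[ v ] w u v) ≡ ∑[ u ] (∑[ v ] (𝟙 (u <?ᶠ v) * (w u v + w v u)))
∑∑-oriented w diag = begin
  ∑[ u ] (∑[ v ] w u v)
    ≡⟨ ∑-cong (λ u → trans (∑-cong (split u)) (∑-+ (λ v → 𝟙 (u <?ᶠ v) * w u v) (λ v → 𝟙 (v <?ᶠ u) * w u v))) ⟩
  ∑[ u ] (∑[ v ] (𝟙 (u <?ᶠ v) * w u v) + ∑[ v ] (𝟙 (v <?ᶠ u) * w u v))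
    ≡⟨ ∑-+ (λ u → ∑[ v ] (𝟙 (u <?ᶠ v) * w u v)) (λ u → ∑[ v ] (𝟙 (v <?ᶠ u) * w u v)) ⟩
  ∑[ u ] (∑[ v ] (𝟙 (u <?ᶠ v) * w u v)) + ∑[ u ] (∑[ v ] (𝟙 (v <?ᶠ u) * w u v))
    ≡⟨ cong (∑[ u ] (∑[ v ] (𝟙 (u <?ᶠ v) * w u v)) +_) (∑-swap (λ u v → 𝟙 (v <?ᶠ u) * w u v)) ⟩
  ∑[ u ] (∑[ v ] (𝟙 (u <?ᶠ v) * w u v)) + ∑[ u ] (∑[ v ] (𝟙 (u <?ᶠ v) * w v u))
    ≡⟨ ∑-+ (λ u → ∑[ v ] (𝟙 (u <?ᶠ v) * w u v)) (λ u → ∑[ v ] (𝟙 (u <?ᶠ v) * w v u)) ⟨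
  ∑[ u ] (∑[ v ] (𝟙 (u <?ᶠ v) * w u v) + ∑[ v ] (𝟙 (u <?ᶠ v) * w v u))
    ≡⟨ ∑-cong (λ u → trans (∑-cong (λ v → *-distribˡ-+ (𝟙 (u <?ᶠ v)) (w u v) (w v u)))
         (∑-+ (λ v → 𝟙 (u <?ᶠ v) * w u v) (λ v → 𝟙 (u <?ᶠ v) * w v u))) ⟨
  ∑[ u ] (∑[ v ] (𝟙 (u <?ᶠ v) * (w u v + w v u))) ∎
  where
  open ≡-Reasoning
  split : ∀ u v → w u v ≡ 𝟙 (u <?ᶠ v) * w u v + 𝟙 (v <?ᶠ u) * w u v
  split u v with <-cmpᶠ u v
  ... | tri< u<v _ v≮u = sym (trans (cong₂ (λ a b → a * w u v + b * w u v)
          (𝟙-yes (u <?ᶠ v) u<v) (𝟙-no (v <?ᶠ u) v≮u)) (trans (+-identityʳ _) (*-identityˡ _)))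
  ... | tri> u≮v _ v<u = sym (trans (cong₂ (λ a b → a * w u v + b * w u v)
          (𝟙-no (u <?ᶠ v) u≮v) (𝟙-yes (v <?ᶠ u) v<u)) (*-identityˡ _))
  ... | tri≈ _ refl _  = trans (diag u) (sym (trans (cong (λ t → 𝟙 (u <?ᶠ u) * t + 𝟙 (u <?ᶠ u) * t) (diag u))
          (cong₂ _+_ (*-zeroʳ (𝟙 (u <?ᶠ u))) (*-zeroʳ (𝟙 (u <?ᶠ u))))))

size≡∑∑ : (F : EdgeSet n) → size F ≡ ∑[ u ] (∑[ v ] (𝟙 (u <?ᶠ v) * 𝟙 (adj? F u v)))
size≡∑∑ F = sym (trans (∑-cong (λ u → trans (∑-cong (λ v → sym (𝟙-× (u <?ᶠ v) (adj? F u v))))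
  (∑≡sum (λ v → 𝟙 ((u <?ᶠ v) ×-dec adj? F u v))))) (∑≡sum _))

boundary-oriented : (G : Graph n) (X : Subset n) → boundary G X ≡
  ∑[ u ] (∑[ v ] (𝟙 (u <?ᶠ v) * (𝟙 (crosses? G X u v) + 𝟙 (crosses? G X v u))))
boundary-oriented G X = trans (boundary≡∑∑ G X) (∑∑-oriented (λ u v → 𝟙 (crosses? G X u v))
  (λ u → 𝟙-no (crosses? G X u u) (λ (p , q , _) → q p)))

boundary≤size : (F : EdgeSet n) (X : Subset n) → boundary F X ≤ size F
boundary≤size F X = begin
  boundary F X
    ≡⟨ boundary-oriented F X ⟩
  ∑[ u ] (∑[ v ] (𝟙 (u <?ᶠ v) * (𝟙 (crosses? F X u v) + 𝟙 (crosses? F X v u))))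
    ≤⟨ ∑-mono (λ u → ∑-mono (λ v → *-monoʳ-≤ (𝟙 (u <?ᶠ v)) (≤-trans
         (≤-reflexive (sym (𝟙-⊎ (crosses? F X u v) (crosses? F X v u) (λ ((p , _) , (_ , q , _)) → q p))))
         (𝟙-mono (crosses? F X u v ⊎-dec crosses? F X v u) (adj? F u v)
           [ (λ (_ , _ , uv) → uv) , (λ (_ , _ , vu) → adj-sym F vu) ]′)))) ⟩
  ∑[ u ] (∑[ v ] (𝟙 (u <?ᶠ v) * 𝟙 (adj? F u v)))
    ≡⟨ size≡∑∑ F ⟨
  size F ∎
  where open ≤-Reasoning

-- The edge-cut around `X`. `Crosses` points out of `X`, so both orientations are needed for a
-- symmetric relation.
δ : Graph n → Subset n → EdgeSet n
δ G X = record
  { Adj        = λ u v → Crosses G X u v ⊎ Crosses G X v u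
  ; adj?       = λ u v → crosses? G X u v ⊎-dec crosses? G X v u
  ; adj-sym    = λ { (inj₁ c) → inj₂ c ; (inj₂ c) → inj₁ c }
  ; adj-irrefl = λ { u (inj₁ (p , q , _)) → q p ; u (inj₂ (p , q , _)) → q p }
  }

δ⊆ : (G : Graph n) (X : Subset n) → δ G X ⊆ᴱ G
δ⊆ G X (inj₁ (_ , _ , uv)) = uv
δ⊆ G X (inj₂ (_ , _ , vu)) = adj-sym G vu

size-δ : (G : Graph n) (X : Subset n) → size (δ G X) ≡ boundary G X
size-δ G X = trans (size≡∑∑ (δ G X)) (trans (∑-cong (λ u → ∑-cong (λ v → cong (𝟙 (u <?ᶠ v) *_)
  (𝟙-⊎ (crosses? G X u v) (crosses? G X v u) (λ ((p , _) , (_ , q , _)) → q p)))))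
  (sym (boundary-oriented G X)))

δ-closed : (G : Graph n) (X : Subset n) → ∀ {u v} → ¬ Crosses (G ─ δ G X) X u v
δ-closed G X (p , q , (uv , ¬δ)) = ¬δ (inj₁ (p , q , uv))

δ-disconnects : (G : Graph n) (X : Subset n) {u v : Fin n} → u ∈ X → v ∉ X → ¬ Connected (G ─ δ G X)
δ-disconnects G X {u} {v} u∈X v∉X conn = v∉X (closed-star (G ─ δ G X) X (δ-closed G X) (conn u v) u∈X)

edgeConnected⇒boundary : (k : ℕ) (G : Graph n) → EdgeConnected k G →
                         (X : Subset n) {u v : Fin n} → u ∈ X → v ∉ X → k ≤ boundary G X
edgeConnected⇒boundary k G (_ , conn) X u∈X v∉X = ≮⇒≥ (λ lt →
  δ-disconnects G X u∈X v∉X (conn (δ G X) (δ⊆ G X) (subst (_< k) (sym (size-δ G X)) lt)))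

-- Linear arithmetic: l ≤ r is the sum of the hypotheses and t the slack.

linear : ∀ {l r} a b t → a + r + t ≡ b + l → l ≤ r → a ≤ b
linear {l} {r} a b t eq l≤r = +-cancelʳ-≤ r a b
  (≤-trans (m≤m+n (a + r) t) (≤-trans (≤-reflexive eq) (+-monoʳ-≤ b l≤r)))

-- Parity makes the odd unit harmless; it absorbs the odd squares 1 and 9 in the density bound for
-- sets of one and three vertices.
halve : ∀ {a b} → 2 * a ≤ 2 * b + 1 → a ≤ b
halve {a} {b} le = ≮⇒≥ (λ b<a → contradiction
  (linear 1 0 0 (identity a b) (+-mono-≤ le (+-mono-≤ b<a b<a))) (λ ()))
  where
  identity : ∀ a b → 1 + (2 * b + 1 + (a + a)) + 0 ≡ 0 + (2 * a + (suc b + suc b))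
  identity = solve-∀

-- Descent on the value of `f`, which also serves as fuel. Deciding whether a strict improvement
-- exists takes the place of an enumeration of `A`; this suits edges packaged with their adjacency
-- proofs.
minimise : {A : Set} (f : A → ℕ) → (∀ b → Dec (∃[ a ] f a < b)) → A → ∃[ a ] (∀ a′ → f a ≤ f a′)
minimise {A} f better? a₀ = descend (f a₀) a₀ ≤-refl
  where
  descend : (fuel : ℕ) (a : A) → f a ≤ fuel → ∃[ a ] (∀ a′ → f a ≤ f a′)
  descend fuel a fa≤ with better? (f a)
  ... | no none = a , λ a′ → ≮⇒≥ (λ lt → none (a′ , lt))
  descend zero a fa≤ | yes (a′ , lt) = contradiction (<-≤-trans lt fa≤) (λ ())
  descend (suc fuel) a fa≤ | yes (a′ , lt) = descend fuel a′ (s≤s⁻¹ (<-≤-trans lt fa≤))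

nbr≥1 : (G : Graph n) (Y : Subset n) {u y : Fin n} → y ∈ Y → Adj G u y → 1 ≤ nbr G (χ Y) u
nbr≥1 G Y {u} {y} y∈Y uy = begin
  1                               ≡⟨ cong₂ _*_ (𝟙-yes (y ∈? Y) y∈Y) (𝟙-yes (adj? G u y) uy) ⟨
  χ Y y * 𝟙 (adj? G u y)          ≤⟨ term≤∑ (λ v → χ Y v * 𝟙 (adj? G u v)) y ⟩
  ∑[ v ] (χ Y v * 𝟙 (adj? G u v)) ≡⟨ nbr-def G (χ Y) u ⟨
  nbr G (χ Y) u                   ∎
  where open ≤-Reasoning

degree≡∑ : (G : Graph n) (u : Fin n) → degree G u ≡ ∑[ v ] 𝟙 (adj? G u v)
degree≡∑ G u = sym (∑≡sum (λ v → 𝟙 (adj? G u v)))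

∑-equals : (y : Fin n) → ∑[ v ] 𝟙 (v ≟ᶠ y) ≡ 1
∑-equals y = trans (∑-cong (λ v → sym (*-identityˡ (𝟙 (v ≟ᶠ y))))) (∑-select (λ _ → 1) y)

degree-mono : (H G : Graph n) → H ⊆ᴱ G → ∀ u → degree H u ≤ degree G u
degree-mono H G H⊆G u = subst₂ _≤_ (sym (degree≡∑ H u)) (sym (degree≡∑ G u))
  (∑-mono (λ v → 𝟙-mono (adj? H u v) (adj? G u v) H⊆G))

degree-drop : (H G : Graph n) → H ⊆ᴱ G → ∀ {u y} → Adj G u y → ¬ Adj H u y → suc (degree H u) ≤ degree G u
degree-drop H G H⊆G {u} {y} uy ¬uy = begin
  suc (degree H u)
    ≡⟨ cong₂ _+_ (sym (∑-equals y)) (degree≡∑ H u) ⟩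
  ∑[ v ] 𝟙 (v ≟ᶠ y) + ∑[ v ] 𝟙 (adj? H u v)
    ≡⟨ ∑-+ (λ v → 𝟙 (v ≟ᶠ y)) (λ v → 𝟙 (adj? H u v)) ⟨
  ∑[ v ] (𝟙 (v ≟ᶠ y) + 𝟙 (adj? H u v))
    ≤⟨ ∑-mono (λ v → ≤-trans
         (≤-reflexive (sym (𝟙-⊎ (v ≟ᶠ y) (adj? H u v) (λ { (refl , h) → ¬uy h }))))
         (𝟙-mono ((v ≟ᶠ y) ⊎-dec adj? H u v) (adj? G u v) [ (λ { refl → uy }) , H⊆G ]′)) ⟩
  ∑[ v ] 𝟙 (adj? G u v)
    ≡⟨ degree≡∑ G u ⟨
  degree G u ∎
  where open ≤-Reasoning

hub-connected : (G : Graph n) (X : Subset n) (c : Fin n) → c ∈ X →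
                (∀ u → u ∈ X → u ≡ c ⊎ Adj G u c) → InducedConnected G X
hub-connected G X c c∈X hub {u} {v} u∈X v∈X = to-hub u u∈X ◅◅ from-hub v v∈X
  where
  to-hub : ∀ u → u ∈ X → Star (λ a b → a ∈ X × b ∈ X × Adj G a b) u c
  to-hub u u∈X with hub u u∈X
  ... | inj₁ refl = ε
  ... | inj₂ uc   = (u∈X , c∈X , uc) ◅ ε
  from-hub : ∀ v → v ∈ X → Star (λ a b → a ∈ X × b ∈ X × Adj G a b) c v
  from-hub v v∈X with hub v v∈X
  ... | inj₁ refl = ε
  ... | inj₂ vc   = (c∈X , v∈X , adj-sym G vc) ◅ ε

pair-connected : (G : Graph n) {x y : Fin n} → Adj G x y → InducedConnected G ⟦ x ⸴ y ⟧
pair-connected G {x} {y} xy = hub-connected G ⟦ x ⸴ y ⟧ x (∈-pairˡ x y)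
  (λ u u∈ → [ inj₁ , (λ { refl → inj₂ (adj-sym G xy) }) ]′ (∈-pair⁻ u∈))

pair-adjacent : (G : Graph n) {x y : Fin n} → x ≢ y → InducedConnected G ⟦ x ⸴ y ⟧ → Adj G x y
pair-adjacent G {x} {y} x≢y conn = first (conn (∈-pairˡ x y) (∈-pairʳ x y))
  where
  first : Star (λ a b → a ∈ ⟦ x ⸴ y ⟧ × b ∈ ⟦ x ⸴ y ⟧ × Adj G a b) x y → Adj G x y
  first ε = contradiction refl x≢y
  first ((_ , b∈ , xb) ◅ _) with ∈-pair⁻ {x = x} {y} b∈
  ... | inj₁ refl = contradiction xb (adj-irrefl G x)
  ... | inj₂ refl = xb

-- Edge-cuts

-- An edge from `w` to another vertex outside `X` survives the deletion, so `w` together with all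
-- its neighbours lies in `X` or `C`.
cut-component-degree : (G : Graph n) (X C : Subset n) → IsComponent (G ─ δ G X) C →
                       ∀ {w} → w ∈ C → w ∉ X → suc (degree G w) ≤ ∣ X ∣ + ∣ C ∣
cut-component-degree G X C isC {w} w∈C w∉X = begin
  suc (degree G w)
    ≡⟨ cong₂ _+_ (sym (∑-equals w)) (degree≡∑ G w) ⟩
  ∑[ v ] 𝟙 (v ≟ᶠ w) + ∑[ v ] 𝟙 (adj? G w v)
    ≡⟨ ∑-+ (λ v → 𝟙 (v ≟ᶠ w)) (λ v → 𝟙 (adj? G w v)) ⟨
  ∑[ v ] (𝟙 (v ≟ᶠ w) + 𝟙 (adj? G w v))
    ≤⟨ ∑-mono bound ⟩
  ∑[ v ] (χ X v + χ C v)
    ≡⟨ ∑-+ (χ X) (χ C) ⟩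
  ∑[ v ] χ X v + ∑[ v ] χ C v
    ≡⟨ cong₂ _+_ (∑χ X) (∑χ C) ⟩
  ∣ X ∣ + ∣ C ∣ ∎
  where
  open ≤-Reasoning
  in-union : ∀ v → v ≡ w ⊎ Adj G w v → v ∈ X ⊎ v ∈ C
  in-union v (inj₁ refl) = inj₂ w∈C
  in-union v (inj₂ wv) with v ∈? X | v ∈? C
  ... | yes v∈X | _       = inj₁ v∈X
  ... | no _    | yes v∈C = inj₂ v∈C
  ... | no v∉X  | no v∉C  = contradiction
    (w∈C , v∉C , wv , [ (λ (p , _) → w∉X p) , (λ (p , _) → v∉X p) ]′)
    (component-closed (G ─ δ G X) C isC)
  𝟙-⊎-≤ : {P Q : Set} (P? : Dec P) (Q? : Dec Q) → 𝟙 (P? ⊎-dec Q?) ≤ 𝟙 P? + 𝟙 Q?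
  𝟙-⊎-≤ (yes _) _       = s≤s z≤n
  𝟙-⊎-≤ (no _)  (yes _) = ≤-refl
  𝟙-⊎-≤ (no _)  (no _)  = ≤-refl
  bound : ∀ v → 𝟙 (v ≟ᶠ w) + 𝟙 (adj? G w v) ≤ χ X v + χ C v
  bound v = ≤-trans
    (≤-reflexive (sym (𝟙-⊎ (v ≟ᶠ w) (adj? G w v) (λ { (refl , ww) → adj-irrefl G w ww }))))
    (≤-trans (𝟙-mono ((v ≟ᶠ w) ⊎-dec adj? G w v) ((v ∈? X) ⊎-dec (v ∈? C)) (in-union v))
      (𝟙-⊎-≤ (v ∈? X) (v ∈? C)))

-- Edges inside `X` survive, so a component rooted in `X` contains all of `X`. Only components with
-- a vertex outside `X` are left to the caller.
δ-extraCut : (h : ℕ) (G : Graph n) (X : Subset n) {u v : Fin n} → u ∈ X → v ∉ X →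
             InducedConnected G X → h < ∣ X ∣ →
             (∀ C w → IsComponent (G ─ δ G X) C → w ∈ C → w ∉ X → h < ∣ C ∣) →
             IsExtraEdgeCut h G (δ G X)
δ-extraCut h G X u∈X v∉X conn h<∣X∣ others =
  δ⊆ G X , δ-disconnects G X u∈X v∉X , large
  where
  large : ∀ C → IsComponent (G ─ δ G X) C → h < ∣ C ∣
  large C isC@(r , iff) with r ∈? X
  ... | no r∉X  = others C r isC (Equivalence.from (iff r) ε) r∉X
  ... | yes r∈X = <-≤-trans h<∣X∣ (p⊆q⇒∣p∣≤∣q∣ (λ {x} x∈X → Equivalence.from (iff x)
    (Star.map (λ (p , q , ab) → ab , [ (λ (_ , ¬q , _) → ¬q q) , (λ (_ , ¬p , _) → ¬p p) ]′)
      (conn r∈X x∈X))))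

-- Every edge of `G` leaving a component of `G ─ S` belongs to `S`.
component-boundary≤size : (G S : Graph n) (C : Subset n) → IsComponent (G ─ S) C → boundary G C ≤ size S
component-boundary≤size G S C isC = begin
  boundary G C                          ≤⟨ boundary-─ G S C ⟩
  boundary (G ─ S) C + boundary S C     ≡⟨ cong (_+ boundary S C)
    (boundary-zero (G ─ S) C (component-closed (G ─ S) C isC)) ⟩
  boundary S C                          ≤⟨ boundary≤size S C ⟩
  size S                                ∎
  where open ≤-Reasoning

-- The two components are disjoint. This is recorded as a size bound, which turns a lower bound on
-- `D` into one on the complement of `C`.
record TwoComponents (G S : Graph n) : Set where
  field
    C D     : Subset n
    isC     : IsComponent (G ─ S) C
    isD     : IsComponent (G ─ S) D
    ∣D∣≤∣∁C∣ : ∣ D ∣ ≤ ∣ ∁ C ∣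

two-components : (G S : Graph n) → ¬ Connected (G ─ S) → TwoComponents G S
two-components G S disc with any? (λ u → any? (λ v → ¬? (v ∈? proj₁ (component (G ─ S) u))))
... | no none = contradiction conn disc
  where
  conn : Connected (G ─ S)
  conn u v with v ∈? proj₁ (component (G ─ S) u)
  ... | yes p = Equivalence.to (proj₂ (component (G ─ S) u) v) p
  ... | no ¬p = contradiction (u , v , ¬p) none
... | yes (u , v , v∉C) = record
  { C = C ; D = D ; isC = u , iffC ; isD = v , iffD
  ; ∣D∣≤∣∁C∣ = p⊆q⇒∣p∣≤∣q∣ (λ {x} x∈D → x∉p⇒x∈∁p (λ x∈C →
      v∉C (Equivalence.from (iffC v) (Equivalence.to (iffC x) x∈C ◅◅
        star-sym (G ─ S) (Equivalence.to (iffD x) x∈D))))) }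
  where
  C = proj₁ (component (G ─ S) u)
  iffC = proj₂ (component (G ─ S) u)
  D = proj₁ (component (G ─ S) v)
  iffD = proj₂ (component (G ─ S) v)

component-neighbour : (G : Graph n) (C : Subset n) → IsComponent G C → ∀ {a c} → a ∈ C → c ∈ C → a ≢ c →
                      ∃[ b ] (b ∈ C × Adj G a b)
component-neighbour G C isC {a} {c} a∈C c∈C a≢c = first (component-star G C isC a∈C c∈C)
  where
  first : Star (Adj G) a c → ∃[ b ] (b ∈ C × Adj G a b)
  first ε = contradiction refl a≢c
  first (_◅_ {j = b} ab _) with b ∈? C
  ... | yes b∈C = b , b∈C , ab
  ... | no b∉C  = contradiction (a∈C , b∉C , ab) (component-closed G C isC)

record Path₃ (G : Graph n) (C : Subset n) : Set where
  field
    x y z : Fin n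
    x≢z   : x ≢ z
    xy    : Adj G x y
    yz    : Adj G y z
    C≡    : C ≡ ⁅ z ⁆ ∪ ⟦ x ⸴ y ⟧

-- Each of the three vertices has a neighbour among the other two, and such choices always contain
-- two edges with a common middle. The end `z` is set apart in the form that `boundary-insert`
-- expects.
path₃ : (G : Graph n) (C : Subset n) → IsComponent G C → ∣ C ∣ ≡ 3 → Path₃ G C
path₃ G C isC ∣C∣ with pick C ∣C∣
... | a , Y , a∉Y , ∣Y∣ , refl with ∣X∣≡2⇒pair Y ∣Y∣
... | b , c , b≢c , refl = from-neighbours (nbr-of a b∈ a∈ (a≢b ∘ sym)) (nbr-of b a∈ b∈ a≢b) (nbr-of c a∈ c∈ a≢c)
  where
  T = ⁅ a ⁆ ∪ ⟦ b ⸴ c ⟧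
  a≢b : a ≢ b
  a≢b refl = a∉Y (∈-pairˡ b c)
  a≢c : a ≢ c
  a≢c refl = a∉Y (∈-pairʳ b c)
  a∈ : a ∈ T
  a∈ = x∈p∪q⁺ (inj₁ (x∈⁅x⁆ a))
  b∈ : b ∈ T
  b∈ = x∈p∪q⁺ (inj₂ (∈-pairˡ b c))
  c∈ : c ∈ T
  c∈ = x∈p∪q⁺ (inj₂ (∈-pairʳ b c))
  nbr-of : ∀ v {w} → w ∈ T → v ∈ T → w ≢ v → Adj G v a ⊎ (Adj G v b ⊎ Adj G v c)
  nbr-of v w∈ v∈ w≢v with component-neighbour G T isC v∈ w∈ (w≢v ∘ sym)
  ... | t , t∈ , vt with x∈p∪q⁻ ⁅ a ⁆ ⟦ b ⸴ c ⟧ t∈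
  ... | inj₁ p = inj₁ (subst (Adj G v) (x∈⁅y⁆⇒x≡y a p) vt)
  ... | inj₂ p with ∈-pair⁻ {x = b} {c} p
  ... | inj₁ refl = inj₂ (inj₁ vt)
  ... | inj₂ refl = inj₂ (inj₂ vt)
  last-c : T ≡ ⁅ c ⁆ ∪ ⟦ a ⸴ b ⟧
  last-c = trans (sym (∪-assoc ⁅ a ⁆ ⁅ b ⁆ ⁅ c ⁆)) (∪-comm ⟦ a ⸴ b ⟧ ⁅ c ⁆)
  last-b : T ≡ ⁅ b ⁆ ∪ ⟦ a ⸴ c ⟧
  last-b = trans (cong (⁅ a ⁆ ∪_) (∪-comm ⁅ b ⁆ ⁅ c ⁆))
    (trans (sym (∪-assoc ⁅ a ⁆ ⁅ c ⁆ ⁅ b ⁆)) (∪-comm ⟦ a ⸴ c ⟧ ⁅ b ⁆))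
  from-neighbours : Adj G a a ⊎ (Adj G a b ⊎ Adj G a c) → Adj G b a ⊎ (Adj G b b ⊎ Adj G b c) →
                    Adj G c a ⊎ (Adj G c b ⊎ Adj G c c) → Path₃ G T
  from-neighbours (inj₁ aa) _ _ = contradiction aa (adj-irrefl G a)
  from-neighbours _ (inj₂ (inj₁ bb)) _ = contradiction bb (adj-irrefl G b)
  from-neighbours _ _ (inj₂ (inj₂ cc)) = contradiction cc (adj-irrefl G c)
  from-neighbours (inj₂ (inj₁ ab)) _ (inj₁ ca) = record
    { x = b ; y = a ; z = c ; x≢z = b≢c ; xy = adj-sym G ab ; yz = adj-sym G ca
    ; C≡ = trans last-c (cong (⁅ c ⁆ ∪_) (∪-comm ⁅ a ⁆ ⁅ b ⁆)) }
  from-neighbours (inj₂ (inj₁ ab)) _ (inj₂ (inj₁ cb)) = record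
    { x = a ; y = b ; z = c ; x≢z = a≢c ; xy = ab ; yz = adj-sym G cb ; C≡ = last-c }
  from-neighbours (inj₂ (inj₂ ac)) (inj₁ ba) _ = record
    { x = c ; y = a ; z = b ; x≢z = b≢c ∘ sym ; xy = adj-sym G ac ; yz = adj-sym G ba
    ; C≡ = trans last-b (cong (⁅ b ⁆ ∪_) (∪-comm ⁅ a ⁆ ⁅ c ⁆)) }
  from-neighbours (inj₂ (inj₂ ac)) (inj₂ (inj₂ bc)) _ = record
    { x = a ; y = c ; z = b ; x≢z = a≢b ; xy = ac ; yz = adj-sym G bc ; C≡ = last-b }

-- Regularity evaluates the left side of `degree-sum`, and `mantel` bounds the inner edges. All
-- terms are doubled so that the square need not be halved.
density : ∀ {d} (G : Graph n) → Regular d G → TriangleFree G → (X : Subset n) →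
          2 * (d * ∣ X ∣) ≤ 2 * boundary G X + ∣ X ∣ * ∣ X ∣
density {d = d} G reg tf X = begin
  2 * (d * ∣ X ∣)                                   ≡⟨ cong (2 *_) total ⟩
  2 * (boundary G X + pairs G (χ X) (χ X))          ≡⟨ *-distribˡ-+ 2 (boundary G X) _ ⟩
  2 * boundary G X + 2 * pairs G (χ X) (χ X)        ≤⟨ +-monoʳ-≤ (2 * boundary G X) (mantel G tf X) ⟩
  2 * boundary G X + ∣ X ∣ * ∣ X ∣                  ∎
  where
  open ≤-Reasoning
  total : d * ∣ X ∣ ≡ boundary G X + pairs G (χ X) (χ X)
  total = begin-equality
    d * ∣ X ∣                    ≡⟨ cong (d *_) (∑χ X) ⟨
    d * ∑[ u ] χ X u             ≡⟨ ∑-*ˡ d (χ X) ⟨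
    ∑[ u ] (d * χ X u)           ≡⟨ ∑-cong (λ u → trans (*-comm d (χ X u))
                                      (cong (χ X u *_) (sym (reg u)))) ⟩
    ∑[ u ] (χ X u * degree G u)  ≡⟨ degree-sum G X ⟩
    boundary G X + pairs G (χ X) (χ X) ∎

-- Regular triangle-free graphs in which large sets have large boundary

module _ {N k : ℕ} (3≤k : 3 ≤ k) (G : Graph N) (reg : Regular (k + 2) G) (tf : TriangleFree G)
         (iso : ∀ X → 4 ≤ ∣ X ∣ → 4 ≤ ∣ ∁ X ∣ → 3 * k + 3 ≤ boundary G X) (v₀ : Fin N) where

  -- Lower bounds for the boundary

  private
    density-at : (X : Subset N) (x : ℕ) → ∣ X ∣ ≡ x → 2 * ((k + 2) * x) ≤ 2 * boundary G X + x * x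
    density-at X x refl = density G reg tf X

    boundary₁ : (X : Subset N) → ∣ X ∣ ≡ 1 → k + 2 ≤ boundary G X
    boundary₁ X eq = halve (linear (2 * (k + 2)) (2 * boundary G X + 1) 0
        (identity k (boundary G X)) (density-at X 1 eq))
      where
      identity : ∀ k b → 2 * (k + 2) + (2 * b + 1) + 0 ≡ 2 * b + 1 + 2 * ((k + 2) * 1)
      identity = solve-∀

    boundary₂ : (X : Subset N) → ∣ X ∣ ≡ 2 → 2 * k + 2 ≤ boundary G X
    boundary₂ X eq = halve (linear (2 * (2 * k + 2)) (2 * boundary G X + 1) 1
        (identity k (boundary G X)) (density-at X 2 eq))
      where
      identity : ∀ k b → 2 * (2 * k + 2) + (2 * b + 4) + 1 ≡ 2 * b + 1 + 2 * ((k + 2) * 2)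
      identity = solve-∀

    boundary₃ : (X : Subset N) → ∣ X ∣ ≡ 3 → 3 * k + 2 ≤ boundary G X
    boundary₃ X eq = halve (linear (2 * (3 * k + 2)) (2 * boundary G X + 1) 0
        (identity k (boundary G X)) (density-at X 3 eq))
      where
      identity : ∀ k b → 2 * (3 * k + 2) + (2 * b + 9) + 0 ≡ 2 * b + 1 + 2 * ((k + 2) * 3)
      identity = solve-∀

    -- Lowers the threshold on both sides from j+1 to j: a side with exactly `j` vertices is handled
    -- by the first bound, after complementing if necessary.
    raise : (j b : ℕ) → (∀ X → ∣ X ∣ ≡ j → b ≤ boundary G X) →
            (∀ X → suc j ≤ ∣ X ∣ → suc j ≤ ∣ ∁ X ∣ → b ≤ boundary G X) →
            ∀ X → j ≤ ∣ X ∣ → j ≤ ∣ ∁ X ∣ → b ≤ boundary G X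
    raise j b small large X j≤ j≤∁ with m≤n⇒m<n∨m≡n j≤ | m≤n⇒m<n∨m≡n j≤∁
    ... | inj₂ eq | _       = small X (sym eq)
    ... | inj₁ _  | inj₂ eq = subst (b ≤_) (boundary-∁ G X) (small (∁ X) (sym eq))
    ... | inj₁ lt | inj₁ lt∁ = large X lt lt∁

    boundary≥₃ : ∀ X → 3 ≤ ∣ X ∣ → 3 ≤ ∣ ∁ X ∣ → 3 * k + 2 ≤ boundary G X
    boundary≥₃ = raise 3 (3 * k + 2) boundary₃
      (λ X p q → ≤-trans (+-monoʳ-≤ (3 * k) (s≤s (s≤s z≤n))) (iso X p q))

    boundary≥₂ : ∀ X → 2 ≤ ∣ X ∣ → 2 ≤ ∣ ∁ X ∣ → 2 * k + 2 ≤ boundary G X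
    boundary≥₂ = raise 2 (2 * k + 2) boundary₂
      (λ X p q → ≤-trans (+-monoˡ-≤ 2 (*-monoˡ-≤ k {2} {3} (s≤s (s≤s z≤n)))) (boundary≥₃ X p q))

    boundary≥₁ : ∀ X → 1 ≤ ∣ X ∣ → 1 ≤ ∣ ∁ X ∣ → k + 2 ≤ boundary G X
    boundary≥₁ = raise 1 (k + 2) boundary₁
      (λ X p q → ≤-trans (+-monoˡ-≤ 2 (m≤m+n k _)) (boundary≥₂ X p q))

    separating-boundary : ∀ X u v → u ∈ X → v ∉ X → k + 2 ≤ boundary G X
    separating-boundary X u v u∈X v∉X = boundary≥₁ X (∈⇒∣X∣>0 u∈X) (∈⇒∣X∣>0 (x∉p⇒x∈∁p v∉X))

  -- Super-λ″

  private
    5≤k+2 : 5 ≤ k + 2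
    5≤k+2 = +-monoˡ-≤ 2 3≤k

    first-neighbour : ∃[ x ] (x ∉ ⁅ v₀ ⁆ × Adj G v₀ x)
    first-neighbour = neighbour-outside G ⁅ v₀ ⁆ v₀
      (subst₂ _<_ (sym (∣⁅x⁆∣≡1 v₀)) (sym (reg v₀)) (≤-trans (s≤s (s≤s z≤n)) 5≤k+2))

    x₀ : Fin N
    x₀ = proj₁ first-neighbour

    v₀x₀ : Adj G v₀ x₀
    v₀x₀ = proj₂ (proj₂ first-neighbour)

    second-neighbour : ∃[ z ] (z ∉ ⟦ v₀ ⸴ x₀ ⟧ × Adj G v₀ z)
    second-neighbour = neighbour-outside G ⟦ v₀ ⸴ x₀ ⟧ v₀
      (subst₂ _<_ (sym (∣pair∣ (adj-≢ G v₀x₀))) (sym (reg v₀)) (≤-trans (s≤s (s≤s (s≤s z≤n))) 5≤k+2))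

    z₀ : Fin N
    z₀ = proj₁ second-neighbour

    z₀∉ : z₀ ∉ ⟦ v₀ ⸴ x₀ ⟧
    z₀∉ = proj₁ (proj₂ second-neighbour)

    v₀z₀ : Adj G v₀ z₀
    v₀z₀ = proj₂ (proj₂ second-neighbour)

    -- The path with middle `v₀`. It attains the lower bound for three vertices and so realises both
    -- λ″ and ξ₂.
    T : Subset N
    T = ⁅ z₀ ⁆ ∪ ⟦ v₀ ⸴ x₀ ⟧

    ∣T∣ : ∣ T ∣ ≡ 3
    ∣T∣ = trans (∣insert∣ z₀∉) (cong suc (∣pair∣ (adj-≢ G v₀x₀)))

    v₀∈T : v₀ ∈ T
    v₀∈T = x∈p∪q⁺ (inj₂ (∈-pairˡ v₀ x₀))

    T-connected : InducedConnected G T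
    T-connected = hub-connected G T v₀ v₀∈T hub
      where
      hub : ∀ u → u ∈ T → u ≡ v₀ ⊎ Adj G u v₀
      hub u u∈T with x∈p∪q⁻ ⁅ z₀ ⁆ ⟦ v₀ ⸴ x₀ ⟧ u∈T
      ... | inj₁ p = inj₂ (subst (λ t → Adj G t v₀) (sym (x∈⁅y⁆⇒x≡y z₀ p)) (adj-sym G v₀z₀))
      ... | inj₂ p with ∈-pair⁻ {x = v₀} {x₀} p
      ... | inj₁ eq   = inj₁ eq
      ... | inj₂ refl = inj₂ (adj-sym G v₀x₀)

    boundary-T : boundary G T ≡ 3 * k + 2
    boundary-T = ≤-antisym
      (linear (boundary G T) (3 * k + 2) 0
        (identity (boundary G T) (boundary G ⟦ v₀ ⸴ x₀ ⟧) (nbr G (χ ⟦ v₀ ⸴ x₀ ⟧) z₀) k)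
        (+-mono-≤ (≤-reflexive (sym eq₁)) (+-mono-≤ (≤-reflexive (sym eq₂))
          (+-mono-≤ one≤ one≤))))
      (boundary₃ T ∣T∣)
      where
      one≤ : 1 ≤ nbr G (χ ⟦ v₀ ⸴ x₀ ⟧) z₀
      one≤ = nbr≥1 G ⟦ v₀ ⸴ x₀ ⟧ (∈-pairˡ v₀ x₀) (adj-sym G v₀z₀)
      eq₁ : (k + 2) + (k + 2) ≡ boundary G ⟦ v₀ ⸴ x₀ ⟧ + 2
      eq₁ = trans (cong₂ _+_ (sym (reg v₀)) (sym (reg x₀))) (boundary-edge G v₀x₀)
      eq₂ : boundary G ⟦ v₀ ⸴ x₀ ⟧ + (k + 2) ≡ boundary G T + 2 * nbr G (χ ⟦ v₀ ⸴ x₀ ⟧) z₀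
      eq₂ = trans (cong (boundary G ⟦ v₀ ⸴ x₀ ⟧ +_) (sym (reg z₀))) (boundary-insert G z₀∉)
      identity : ∀ bT bP s k →
        bT + ((k + 2) + (k + 2) + ((bP + (k + 2)) + (s + s))) + 0 ≡
        3 * k + 2 + ((bP + 2) + ((bT + 2 * s) + (1 + 1)))
      identity = solve-∀

    outside-T : ∃[ w ] w ∉ T
    outside-T with neighbour-outside G T v₀ (subst₂ _<_ (sym ∣T∣) (sym (reg v₀)) (≤-trans (n≤1+n 4) 5≤k+2))
    ... | w , w∉ , _ = w , w∉

    T-cut : IsExtraEdgeCut 2 G (δ G T)
    -- A vertex outside `T` has k+3 ≥ 6 vertices in its closed neighbourhood, and `T` accounts for
    -- at most three of them.
    T-cut = δ-extraCut 2 G T v₀∈T (proj₂ outside-T) T-connected (≤-reflexive (sym ∣T∣))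
      (λ C w isC w∈C w∉T → +-cancelˡ-≤ 3 3 ∣ C ∣ (≤-trans (s≤s (≤-trans 5≤k+2 (≤-reflexive (sym (reg w)))))
        (subst (λ t → suc (degree G w) ≤ t + ∣ C ∣) ∣T∣ (cut-component-degree G T C isC w∈C w∉T))))

    connected : Connected G
    connected = connected⁺ G (λ X u v p q → ≤-trans (≤-trans (s≤s z≤n) 5≤k+2) (separating-boundary X u v p q))

    λ″ : Isλ 2 G (3 * k + 2)
    λ″ = (δ G T , T-cut , trans (size-δ G T) boundary-T) , lower
      where
      lower : ∀ S → IsExtraEdgeCut 2 G S → 3 * k + 2 ≤ size S
      lower S (_ , disc , large) = ≤-trans
        (boundary≥₃ C (large C isC) (≤-trans (large D isD) ∣D∣≤∣∁C∣))
        (component-boundary≤size G S C isC)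
        where open TwoComponents (two-components G S disc)

    super-cut″ : ∀ S → IsλCut 2 G S → ∃[ C ] (IsComponent (G ─ S) C × ∣ C ∣ ≡ 3)
    super-cut″ S ((_ , disc , large) , (_ , minimal))
      with m≤n⇒m<n∨m≡n (large C isC) | m≤n⇒m<n∨m≡n (large D isD)
      where open TwoComponents (two-components G S disc)
    ... | inj₂ eq | _       = C , isC , sym eq
      where open TwoComponents (two-components G S disc)
    ... | inj₁ _  | inj₂ eq = D , isD , sym eq
      where open TwoComponents (two-components G S disc)
    ... | inj₁ lt | inj₁ lt′ = contradiction
        (≤-trans (iso C lt (≤-trans lt′ ∣D∣≤∣∁C∣)) (≤-trans (component-boundary≤size G S C isC) size≤))
        (<⇒≱ (+-monoʳ-< (3 * k) (n<1+n 2)))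
      where
      open TwoComponents (two-components G S disc)
      size≤ : size S ≤ 3 * k + 2
      size≤ = subst (size S ≤_) (trans (size-δ G T) boundary-T) (minimal (δ G T) T-cut)

  super-λ″ : Super-λ″ G
  super-λ″ = (connected , 3 * k + 2 , λ″ , (T , (∣T∣ , T-connected) , boundary-T) ,
    λ X (∣X∣ , _) → boundary₃ X ∣X∣) , super-cut″

  -- Super-λ′ for subgraphs whose boundaries drop by at most k + 1

  module _ (H : Graph N) (H⊆G : H ⊆ᴱ G)
           (loss : ∀ X → boundary G X ≤ boundary H X + (k + 1)) where

    private
      connected′ : Connected H
      connected′ = connected⁺ H (λ X u v p q → linear 1 (boundary H X) 0 (identity k (boundary H X))
          (≤-trans (separating-boundary X u v p q) (loss X)))
        where
        identity : ∀ k b → 1 + (b + (k + 1)) + 0 ≡ b + (k + 2)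
        identity = solve-∀

      degree≤ : ∀ u → degree H u ≤ k + 2
      degree≤ u = ≤-trans (degree-mono H G H⊆G u) (≤-reflexive (reg u))

      some-neighbour : ∀ u → ∃[ v ] Adj H u v
      some-neighbour u with neighbour-outside H ⊥ u (subst (_< degree H u) (sym (∣⊥∣≡0 N)) positive)
        where
        positive : 1 ≤ degree H u
        positive = linear 1 (degree H u) 0 (identity k (degree H u))
          (subst₂ _≤_ (trans (boundary-single G u) (reg u)) (cong (_+ (k + 1)) (boundary-single H u)) (loss ⁅ u ⁆))
          where
          identity : ∀ k d → 1 + (d + (k + 1)) + 0 ≡ d + (k + 2)
          identity = solve-∀
      ... | v , _ , uv = v , uv

      -- For a nonadjacent pair the boundary is the degree sum: 2k+4 in `G`, and at most k+1 less in
      -- `H`.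
      nonadjacent-degrees : ∀ {x z} → x ≢ z → ¬ Adj G x z → k + 3 ≤ degree H x + degree H z
      nonadjacent-degrees {x} {z} x≢z ¬xz = linear (k + 3) (degree H x + degree H z) 0
        (identity k (degree H x + degree H z))
        (subst₂ _≤_
          (trans (sym (boundary-nonadjacent G x≢z ¬xz)) (cong₂ _+_ (reg x) (reg z)))
          (cong (_+ (k + 1)) (sym (boundary-nonadjacent H x≢z (¬xz ∘ H⊆G))))
          (loss ⟦ x ⸴ z ⟧))
        where
        identity : ∀ k d → k + 3 + (d + (k + 1)) + 0 ≡ d + ((k + 2) + (k + 2))
        identity = solve-∀

      Edge : Set
      Edge = ∃[ x ] ∃[ y ] Adj H x y

      degrees : Edge → ℕ
      degrees (x , y , _) = degree H x + degree H y

      -- The boundary of an edge is its degree sum minus 2, so this edge attains ξ₁ of `H`.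
      lightest : ∃[ e ] (∀ e′ → degrees e ≤ degrees e′)
      lightest = minimise degrees
        (λ b → map′ (λ (x , y , xy , lt) → (x , y , xy) , lt) (λ ((x , y , xy) , lt) → x , y , xy , lt)
          (any? (λ x → any? (λ y → adj? H x y ×-dec (suc (degree H x + degree H y) ≤? b)))))
        (v₀ , some-neighbour v₀)

    module LightestEdge (u v : Fin N) (uv : Adj H u v)
      (minimal : ∀ {x y} → Adj H x y → degree H u + degree H v ≤ degree H x + degree H y) where

      u≢v : u ≢ v
      u≢v = adj-≢ H uv

      ℓ : ℕ
      ℓ = boundary H ⟦ u ⸴ v ⟧

      ℓ+2 : degree H u + degree H v ≡ ℓ + 2
      ℓ+2 = boundary-edge H uv

      ℓ≤edge : ∀ {x y} → Adj H x y → ℓ ≤ boundary H ⟦ x ⸴ y ⟧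
      ℓ≤edge xy = +-cancelʳ-≤ 2 ℓ _ (subst₂ _≤_ ℓ+2 (boundary-edge H xy) (minimal xy))

      -- A component {w} of H - δ{u,v}, with w adjacent to u say, would make
      -- deg v ≤ deg w ≤ 2 for the nonadjacent vertices v and w.

      cut-component : ∀ {u v} → Adj H u v →
                      (∀ {x y} → Adj H x y → degree H u + degree H v ≤ degree H x + degree H y) →
                      ∀ {w} → w ≢ v → degree H w ≤ 2 → ¬ Adj H w u
      cut-component {u} {v} uv minimal {w} w≢v dw≤2 wu = contradiction
        (linear 1 0 1 (identity (degree H u) (degree H v) (degree H w) k)
          (+-mono-≤ (minimal wu) (+-mono-≤ (nonadjacent-degrees w≢v
            (λ wv → tf w u v (H⊆G wu , H⊆G uv , wv))) (+-mono-≤ 3≤k (+-mono-≤ dw≤2 dw≤2)))))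
        (λ ())
        where
        identity : ∀ du dv dw k →
          1 + ((dw + du) + ((dw + dv) + (k + (2 + 2)))) + 1 ≡
          0 + ((du + dv) + ((k + 3) + (3 + (dw + dw))))
        identity = solve-∀

      swap-minimal : ∀ {x y} → Adj H x y → degree H v + degree H u ≤ degree H x + degree H y
      swap-minimal {x} {y} xy = subst (_≤ degree H x + degree H y) (+-comm (degree H u) (degree H v)) (minimal xy)

      -- For a component of at most one vertex, the neighbour count yields only deg w ≤ 2. But `w`
      -- has a neighbour, which must be `u` or `v`, and `cut-component` excludes both.
      others : ∀ C w → IsComponent (H ─ δ H ⟦ u ⸴ v ⟧) C → w ∈ C → w ∉ ⟦ u ⸴ v ⟧ → 2 ≤ ∣ C ∣
      others C w isC w∈C w∉ with 2 ≤? ∣ C ∣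
      ... | yes large = large
      ... | no small  = contradiction (proj₂ (some-neighbour w)) (isolated (proj₁ (some-neighbour w)))
        where
        dw≤2 : degree H w ≤ 2
        dw≤2 = s≤s⁻¹ (≤-trans (cut-component-degree H ⟦ u ⸴ v ⟧ C isC w∈C w∉)
          (≤-trans (≤-reflexive (cong (_+ ∣ C ∣) (∣pair∣ u≢v))) (+-monoʳ-≤ 2 (s≤s⁻¹ (≰⇒> small)))))
        w≢u : w ≢ u
        w≢u refl = w∉ (∈-pairˡ u v)
        w≢v : w ≢ v
        w≢v refl = w∉ (∈-pairʳ u v)
        isolated : ∀ y → ¬ Adj H w y
        isolated y wy with y ≟ᶠ u | y ≟ᶠ v | y ∈? C
        ... | yes refl | _        | _ = cut-component uv minimal w≢v dw≤2 wy
        ... | no _     | yes refl | _ = cut-component (adj-sym H uv) swap-minimal w≢u dw≤2 wy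
        ... | no _     | no _     | yes y∈C = small (pair⊆⇒2≤∣X∣ (adj-≢ H wy) w∈C y∈C)
        ... | no y≢u   | no y≢v   | no y∉C  = component-closed (H ─ δ H ⟦ u ⸴ v ⟧) C isC
          (w∈C , y∉C , wy , [ (λ (p , _) → w∉ p) , (λ (p , _) → ∉-pair y≢u y≢v p) ]′)

      outside-pair : ∃[ w ] w ∉ ⟦ u ⸴ v ⟧
      outside-pair with neighbour-outside G ⟦ u ⸴ v ⟧ u
        (subst₂ _<_ (sym (∣pair∣ u≢v)) (sym (reg u)) (≤-trans (s≤s (s≤s (s≤s z≤n))) 5≤k+2))
      ... | w , w∉ , _ = w , w∉

      pair-cut : IsExtraEdgeCut 1 H (δ H ⟦ u ⸴ v ⟧)
      pair-cut = δ-extraCut 1 H ⟦ u ⸴ v ⟧ (∈-pairˡ u v) (proj₂ outside-pair) (pair-connected H uv)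
        (≤-reflexive (sym (∣pair∣ u≢v))) others

      ξ-lower : ∀ X → ∣ X ∣ ≡ 2 × InducedConnected H X → ℓ ≤ boundary H X
      ξ-lower X (∣X∣ , conn) with ∣X∣≡2⇒pair X ∣X∣
      ... | x , y , x≢y , refl = ℓ≤edge (pair-adjacent H x≢y conn)

      component₂ : ∀ S C → IsComponent (H ─ S) C → ∣ C ∣ ≡ 2 → ℓ ≤ boundary H C
      component₂ S C isC ∣C∣ with ∣X∣≡2⇒pair C ∣C∣
      ... | x , y , x≢y , refl with component-neighbour (H ─ S) C isC (∈-pairˡ x y) (∈-pairʳ x y) x≢y
      ... | b , b∈ , xb , ¬S with ∈-pair⁻ {x = x} {y} b∈
      ... | inj₁ refl = contradiction xb (adj-irrefl H x)
      ... | inj₂ refl = ℓ≤edge xb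

      -- Without triangles `y` is the only neighbour of `z` in the pair, so adding `z` raises the
      -- boundary by deg z minus 2, which is positive.
      extend-edge : ∀ {x y z} → x ≢ z → Adj H x y → Adj H y z → 3 ≤ degree H z →
                    suc ℓ ≤ boundary H (⁅ z ⁆ ∪ ⟦ x ⸴ y ⟧)
      extend-edge {x} {y} {z} x≢z xy yz 3≤dz = linear (suc ℓ) (boundary H (⁅ z ⁆ ∪ ⟦ x ⸴ y ⟧)) 0
        (identity ℓ (boundary H ⟦ x ⸴ y ⟧) (degree H z) (boundary H (⁅ z ⁆ ∪ ⟦ x ⸴ y ⟧)) s)
        (+-mono-≤ (ℓ≤edge xy) (+-mono-≤ (≤-reflexive
          (boundary-insert H (∉-pair {x = x} {y} (x≢z ∘ sym) (adj-≢ H yz ∘ sym))))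
          (+-mono-≤ 3≤dz (+-mono-≤ s≤1 s≤1))))
        where
        s = nbr H (χ ⟦ x ⸴ y ⟧) z
        only-y : ∀ t → t ∈ ⟦ x ⸴ y ⟧ → Adj H z t → t ≡ y
        only-y t t∈ zt with ∈-pair⁻ {x = x} {y} t∈
        ... | inj₂ eq   = eq
        ... | inj₁ refl = contradiction (H⊆G xy , H⊆G yz , H⊆G (adj-sym H zt)) (tf x y z)
        s≤1 : s ≤ 1
        s≤1 = nbr≤1 H ⟦ x ⸴ y ⟧ z y only-y
        identity : ∀ ℓ b d bT s →
          suc ℓ + (b + ((bT + 2 * s) + (d + (1 + 1)))) + 0 ≡ bT + (ℓ + ((b + d) + (3 + (s + s))))
        identity = solve-∀

      -- The ends of the path are nonadjacent in `G`, so their degrees in `H` sum to at least k+3 ≥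
      -- 6 and one of them is at least 3. The path is read so that this end is added last.
      component₃ : ∀ S C → IsComponent (H ─ S) C → ∣ C ∣ ≡ 3 → suc ℓ ≤ boundary H C
      component₃ S C isC ∣C∣ with path₃ (H ─ S) C isC ∣C∣
      ... | record { x = x ; y = y ; z = z ; x≢z = x≢z ; xy = xy , _ ; yz = yz , _ ; C≡ = refl }
        with 3 ≤? degree H z
      ... | yes 3≤dz = extend-edge x≢z xy yz 3≤dz
      ... | no dz<3  = subst (λ X → suc ℓ ≤ boundary H X) reversed
        (extend-edge (x≢z ∘ sym) (adj-sym H yz) (adj-sym H xy) 3≤dx)
        where
        reversed : ⁅ x ⁆ ∪ ⟦ z ⸴ y ⟧ ≡ ⁅ z ⁆ ∪ ⟦ x ⸴ y ⟧
        reversed = trans (sym (∪-assoc ⁅ x ⁆ ⁅ z ⁆ ⁅ y ⁆))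
          (trans (cong (_∪ ⁅ y ⁆) (∪-comm ⁅ x ⁆ ⁅ z ⁆)) (∪-assoc ⁅ z ⁆ ⁅ x ⁆ ⁅ y ⁆))
        3≤dx : 3 ≤ degree H x
        3≤dx = linear 3 (degree H x) 1 (identity k (degree H x) (degree H z))
          (+-mono-≤ (nonadjacent-degrees x≢z (λ xz → tf x y z (H⊆G xy , H⊆G yz , xz)))
            (+-mono-≤ 3≤k (s≤s⁻¹ (≰⇒> dz<3))))
          where
          identity : ∀ k dx dz → 3 + ((dx + dz) + (k + 2)) + 1 ≡ dx + ((k + 3) + (3 + dz))
          identity = solve-∀

      large-sets : ∀ C → 4 ≤ ∣ C ∣ → 4 ≤ ∣ ∁ C ∣ → suc ℓ ≤ boundary H C
      large-sets C 4≤ 4≤∁ with any? (λ x → any? (λ y → adj? G x y ×-dec ¬? (adj? H x y)))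
      ... | no none = linear (suc ℓ) (boundary H C) k (identity ℓ (degree H u) (degree H v) k (boundary H C))
            (+-mono-≤ (≤-trans (iso C 4≤ 4≤∁) (boundary-mono G H C kept))
              (+-mono-≤ (≤-reflexive (sym ℓ+2)) (+-mono-≤ (degree≤ u) (degree≤ v))))
        where
        kept : ∀ {x y} → Crosses G C x y → Adj H x y
        kept {x} {y} (_ , _ , xy) with adj? H x y
        ... | yes p = p
        ... | no ¬p = contradiction (x , y , xy , ¬p) none
        identity : ∀ ℓ du dv k b →
          suc ℓ + (b + ((du + dv) + ((k + 2) + (k + 2)))) + k ≡
          b + ((3 * k + 3) + ((ℓ + 2) + (du + dv)))
        identity = solve-∀
      ... | yes (x , y , xy , ¬xy) with some-neighbour x
      -- The edge from `x` to `t` shows ℓ ≤ 2k+1, one less than what the loss leaves of 3k+3.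
      ...   | t , xt = linear (suc ℓ) (boundary H C) 0
            (identity ℓ (degree H u) (degree H v) (degree H x) (degree H t) k (boundary H C))
            (+-mono-≤ (≤-trans (iso C 4≤ 4≤∁) (loss C))
              (+-mono-≤ (≤-reflexive (sym ℓ+2)) (+-mono-≤ (minimal xt)
                (+-mono-≤ (≤-trans (degree-drop H G H⊆G xy ¬xy) (≤-reflexive (reg x))) (degree≤ t)))))
        where
        identity : ∀ ℓ du dv dx dt k b →
          suc ℓ + ((b + (k + 1)) + ((du + dv) + ((dx + dt) + ((k + 2) + (k + 2))))) + 0 ≡
          b + ((3 * k + 3) + ((ℓ + 2) + ((du + dv) + (suc dx + dt))))
        identity = solve-∀

      -- One case analysis for two purposes: optimality needs size at least ℓ in both alternatives,
      -- and for a minimum cut the strict alternative is impossible.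
      dichotomy : ∀ S C D → IsComponent (H ─ S) C → IsComponent (H ─ S) D → ∣ D ∣ ≤ ∣ ∁ C ∣ →
                  2 ≤ ∣ C ∣ → 2 ≤ ∣ D ∣ → (∣ C ∣ ≡ 2 ⊎ ∣ D ∣ ≡ 2) ⊎ suc ℓ ≤ size S
      dichotomy S C D isC isD ∣D∣≤ 2≤C 2≤D
        with m≤n⇒m<n∨m≡n 2≤C | m≤n⇒m<n∨m≡n 2≤D
      ... | inj₂ eq | _       = inj₁ (inj₁ (sym eq))
      ... | inj₁ _  | inj₂ eq = inj₁ (inj₂ (sym eq))
      ... | inj₁ 3≤C | inj₁ 3≤D with m≤n⇒m<n∨m≡n 3≤C | m≤n⇒m<n∨m≡n 3≤D
      ... | inj₂ eq | _       = inj₂ (≤-trans (component₃ S C isC (sym eq)) (component-boundary≤size H S C isC))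
      ... | inj₁ _  | inj₂ eq = inj₂ (≤-trans (component₃ S D isD (sym eq)) (component-boundary≤size H S D isD))
      ... | inj₁ 4≤C | inj₁ 4≤D = inj₂ (≤-trans (large-sets C 4≤C (≤-trans 4≤D ∣D∣≤))
                                    (component-boundary≤size H S C isC))

      λ-lower : ∀ S → IsExtraEdgeCut 1 H S → ℓ ≤ size S
      λ-lower S (_ , disc , large) with dichotomy S C D isC isD ∣D∣≤∣∁C∣ (large C isC) (large D isD)
        where open TwoComponents (two-components H S disc)
      ... | inj₂ lt          = <⇒≤ lt
      ... | inj₁ (inj₁ ∣C∣≡2) = ≤-trans (component₂ S _ isC ∣C∣≡2) (component-boundary≤size H S _ isC)
        where open TwoComponents (two-components H S disc)
      ... | inj₁ (inj₂ ∣D∣≡2) = ≤-trans (component₂ S _ isD ∣D∣≡2) (component-boundary≤size H S _ isD)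
        where open TwoComponents (two-components H S disc)

      super-cut′ : ∀ S → IsλCut 1 H S → ∃[ C ] (IsComponent (H ─ S) C × ∣ C ∣ ≡ 2)
      super-cut′ S ((_ , disc , large) , (_ , minimum))
        with dichotomy S C D isC isD ∣D∣≤∣∁C∣ (large C isC) (large D isD)
        where open TwoComponents (two-components H S disc)
      ... | inj₁ (inj₁ ∣C∣≡2) = _ , TwoComponents.isC (two-components H S disc) , ∣C∣≡2
      ... | inj₁ (inj₂ ∣D∣≡2) = _ , TwoComponents.isD (two-components H S disc) , ∣D∣≡2
      ... | inj₂ lt = contradiction
        (subst (size S ≤_) (size-δ H ⟦ u ⸴ v ⟧) (minimum (δ H ⟦ u ⸴ v ⟧) pair-cut)) (<⇒≱ lt)

      super : Super-λ′ H
      super = (connected′ , ℓ , ((δ H ⟦ u ⸴ v ⟧ , pair-cut , size-δ H ⟦ u ⸴ v ⟧) , λ-lower) ,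
        (⟦ u ⸴ v ⟧ , (∣pair∣ u≢v , pair-connected H uv) , refl) , ξ-lower) , super-cut′

    super-λ′ : Super-λ′ H
    super-λ′ with lightest
    ... | (u , v , uv) , minimal = LightestEdge.super u v uv (λ xy → minimal (_ , _ , xy))

  persistence : Persistence G (k + 1)
  persistence = super-λ′ G id (λ X → m≤m+n (boundary G X) (k + 1)) , upto , maximal
    where
    upto : Super-λ′-Upto G (k + 1)
    upto F _ small = super-λ′ (G ─ F) proj₁ (λ X → ≤-trans (boundary-─ G F X)
      (+-monoʳ-≤ (boundary (G ─ F) X) (≤-trans (boundary≤size F X) small)))
    maximal : ∀ s → Super-λ′-Upto G s → s ≤ k + 1
    maximal s survives = ≮⇒≥ (λ k+1<s → δ-disconnects G ⁅ v₀ ⁆ (x∈⁅x⁆ v₀) (proj₁ (proj₂ first-neighbour))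
      (proj₁ (proj₁ (survives (δ G ⁅ v₀ ⁆) (δ⊆ G ⁅ v₀ ⁆) (begin
        size (δ G ⁅ v₀ ⁆)    ≡⟨ size-δ G ⁅ v₀ ⁆ ⟩
        boundary G ⁅ v₀ ⁆    ≡⟨ boundary-single G v₀ ⟩
        degree G v₀          ≡⟨ reg v₀ ⟩
        k + 2                ≡⟨ +-suc k 1 ⟩
        suc (k + 1)          ≤⟨ k+1<s ⟩
        s                    ∎)))))
      where open ≤-Reasoning

-- The cyclic successor

toℕ-next : (i : Fin (suc m)) → toℕ (next i) ≡ suc (toℕ i) % suc m
toℕ-next {m} i = toℕ-fromℕ< (m%n<n (suc (toℕ i)) (suc m))

-- The remainder is kept as an equation in ℕ, with the number of completed turns as witness, so that
-- consecutive steps can be added and cancelled.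
next-wraps : (i : Fin (suc m)) → ∃[ c ] toℕ (next i) + c * suc m ≡ suc (toℕ i)
next-wraps {m} i = suc (toℕ i) / suc m ,
  trans (cong (_+ (suc (toℕ i) / suc m) * suc m) (toℕ-next i)) (sym (m≡m%n+[m/n]*n (suc (toℕ i)) (suc m)))

no-multiple : ∀ c j → c * suc m ≡ suc j → ¬ (suc j < suc m)
no-multiple {m} (suc c) j eq lt = <⇒≱ lt (≤-trans (m≤m+n (suc m) (c * suc m)) (≤-reflexive eq))

-- A return after two steps would make 2 a multiple of m.
next²≢ : 3 ≤ m → (i : Fin m) → next (next i) ≢ i
next²≢ {suc m} 3≤m i eq with next-wraps i | next-wraps (next i)
... | c , e | d , e′ = no-multiple (c + d) 1
  (+-cancelˡ-≡ (toℕ i) _ _ (cycle (toℕ i) (toℕ (next i)) c d (suc m) e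
    (subst (λ t → toℕ t + d * suc m ≡ suc (toℕ (next i))) eq e′))) 3≤m
  where
  cycle : ∀ t t₁ c d m → t₁ + c * m ≡ suc t → t + d * m ≡ suc t₁ → t + (c + d) * m ≡ t + 2
  cycle t t₁ c d m e e′ = begin
    t + (c + d) * m      ≡⟨ expand t c d m ⟩
    t + d * m + c * m    ≡⟨ cong (_+ c * m) e′ ⟩
    suc (t₁ + c * m)     ≡⟨ cong suc e ⟩
    suc (suc t)          ≡⟨ +-comm 2 t ⟩
    t + 2                ∎
    where
    open ≡-Reasoning
    expand : ∀ t c d m → t + (c + d) * m ≡ t + d * m + c * m
    expand = solve-∀

-- A return after three steps would make 3 a multiple of m. This excludes triangles made of three
-- matching edges.
next³≢ : 4 ≤ m → (i : Fin m) → next (next (next i)) ≢ i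
next³≢ {suc m} 4≤m i eq with next-wraps i | next-wraps (next i) | next-wraps (next (next i))
... | c , e | d , e′ | b , e″ = no-multiple (c + d + b) 2
  (+-cancelˡ-≡ (toℕ i) _ _ (cycle (toℕ i) (toℕ (next i)) (toℕ (next (next i))) c d b (suc m) e e′
    (subst (λ t → toℕ t + b * suc m ≡ suc (toℕ (next (next i)))) eq e″))) 4≤m
  where
  cycle : ∀ t t₁ t₂ c d b m → t₁ + c * m ≡ suc t → t₂ + d * m ≡ suc t₁ → t + b * m ≡ suc t₂ →
          t + (c + d + b) * m ≡ t + 3
  cycle t t₁ t₂ c d b m e e′ e″ = begin
    t + (c + d + b) * m          ≡⟨ expand t c d b m ⟩
    t + b * m + d * m + c * m    ≡⟨ cong (λ s → s + d * m + c * m) e″ ⟩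
    suc (t₂ + d * m + c * m)     ≡⟨ cong (λ s → suc (s + c * m)) e′ ⟩
    suc (suc (t₁ + c * m))       ≡⟨ cong (λ s → suc (suc s)) e ⟩
    suc (suc (suc t))            ≡⟨ +-comm 3 t ⟩
    t + 3                        ∎
    where
    open ≡-Reasoning
    expand : ∀ t c d b m → t + (c + d + b) * m ≡ t + b * m + d * m + c * m
    expand = solve-∀

prev : Fin m → Fin m
prev {suc m} zero    = fromℕ m
prev {suc m} (suc i) = inject₁ i

next-< : (i : Fin (suc m)) → toℕ i < m → toℕ (next i) ≡ suc (toℕ i)
next-< i lt = trans (toℕ-next i) (m<n⇒m%n≡m (s≤s lt))

next-last : (i : Fin (suc m)) → toℕ i ≡ m → next i ≡ zero
next-last {m} i eq = toℕ-injective (trans (toℕ-next i) (trans (cong (λ t → suc t % suc m) eq) (n%n≡0 (suc m))))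

next-prev : (i : Fin m) → next (prev i) ≡ i
next-prev {suc m} zero    = next-last (fromℕ m) (toℕ-fromℕ m)
next-prev {suc m} (suc i) = toℕ-injective (trans
  (next-< (inject₁ i) (subst (_< m) (sym (toℕ-inject₁ i)) (toℕ<n i))) (cong suc (toℕ-inject₁ i)))

prev-next : (i : Fin m) → prev (next i) ≡ i
prev-next {suc m} i with m≤n⇒m<n∨m≡n (s≤s⁻¹ (toℕ<n i))
... | inj₁ lt = trans (cong prev next≡) (toℕ-injective (trans (toℕ-inject₁ (fromℕ< lt)) (toℕ-fromℕ< lt)))
  where
  next≡ : next i ≡ suc (fromℕ< lt)
  next≡ = toℕ-injective (trans (next-< i lt) (cong suc (sym (toℕ-fromℕ< lt))))
... | inj₂ eq = trans (cong prev (next-last i eq)) (toℕ-injective (trans (toℕ-fromℕ m) (sym eq)))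

-- Variation around a cycle: two arcs lead from p to q.

∑-last : (l : ℕ) (f : ℕ → ℕ) → ∑ {suc l} (f ∘ toℕ) ≡ ∑ {l} (f ∘ toℕ) + f l
∑-last zero    f = trans (∑-suc (f ∘ toℕ)) (trans (+-comm (f 0) _)
  (cong (_+ f 0) (∑-cong {0} {f = f ∘ toℕ ∘ suc} {g = f ∘ toℕ} (λ ()))))
∑-last (suc l) f = begin
  ∑ {suc (suc l)} (f ∘ toℕ)                      ≡⟨ ∑-suc (f ∘ toℕ) ⟩
  f 0 + ∑ {suc l} (f ∘ suc ∘ toℕ)                ≡⟨ cong (f 0 +_) (∑-last l (f ∘ suc)) ⟩
  f 0 + (∑ {l} (f ∘ suc ∘ toℕ) + f (suc l))      ≡⟨ +-assoc (f 0) _ _ ⟨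
  f 0 + ∑ {l} (f ∘ suc ∘ toℕ) + f (suc l)        ≡⟨ cong (_+ f (suc l)) (∑-suc (f ∘ toℕ)) ⟨
  ∑ {suc l} (f ∘ toℕ) + f (suc l)                ∎
  where open ≡-Reasoning

module _ (x c : Fin m → ℕ) (down : ∀ i → x i ≤ x (next i) + c i) (up : ∀ i → x (next i) ≤ x i + c i) where

  variation : ∀ p q → 2 * x p ≤ 2 * x q + ∑ c
  variation p q = go m refl x c down up p q
    where
    go : ∀ m′ → m ≡ m′ → (x c : Fin m′ → ℕ) → (∀ i → x i ≤ x (next i) + c i) →
         (∀ i → x (next i) ≤ x i + c i) → ∀ p q → 2 * x p ≤ 2 * x q + ∑ c
    go zero     _ x c down up () q
    go (suc m′) _ x c down up p q = result
      where
      -- The cycle is unrolled to the positions 0 to m, with `y` equal at both ends. `P` is a prefix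
      -- sum, so the cost of an arc is a difference of two values of `P`, always written additively.
      y d P : ℕ → ℕ
      y t = x (t mod suc m′)
      d t = c (t mod suc m′)
      P t = ∑ {t} (d ∘ toℕ)
      toℕ-mod : ∀ {t} → t < suc m′ → toℕ (t mod suc m′) ≡ t
      toℕ-mod {t} lt = trans (toℕ-fromℕ< (m%n<n t (suc m′))) (m<n⇒m%n≡m lt)
      mod-toℕ : ∀ i → toℕ i mod suc m′ ≡ i
      mod-toℕ i = toℕ-injective (toℕ-mod (toℕ<n i))
      step : ∀ {t} → t < suc m′ → y (suc t) ≡ x (next (t mod suc m′))
      step {t} lt = cong (λ s → x (suc s mod suc m′)) (sym (toℕ-mod lt))
      descend : ∀ a t → a + t ≤ suc m′ → y a + P a ≤ y (a + t) + P (a + t)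
      descend a zero    _  = ≤-reflexive (cong (λ s → y s + P s) (sym (+-identityʳ a)))
      descend a (suc t) le = ≤-trans (descend a t (<⇒≤ lt)) (subst (λ s → y (a + t) + P (a + t) ≤ y s + P s)
          (sym (+-suc a t)) (begin
            y (a + t) + P (a + t)                  ≤⟨ +-monoˡ-≤ (P (a + t)) (down ((a + t) mod suc m′)) ⟩
            x (next ((a + t) mod suc m′)) + d (a + t) + P (a + t)
              ≡⟨ cong (λ s → s + d (a + t) + P (a + t)) (step lt) ⟨
            y (suc (a + t)) + d (a + t) + P (a + t)
              ≡⟨ +-assoc (y (suc (a + t))) _ _ ⟩
            y (suc (a + t)) + (d (a + t) + P (a + t))
              ≡⟨ cong (y (suc (a + t)) +_) (trans (+-comm (d (a + t)) _) (sym (∑-last (a + t) d))) ⟩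
            y (suc (a + t)) + P (suc (a + t))      ∎))
        where
        open ≤-Reasoning
        lt : a + t < suc m′
        lt = subst (_≤ suc m′) (+-suc a t) le
      ascend : ∀ a t → a + t ≤ suc m′ → y (a + t) + P a ≤ y a + P (a + t)
      ascend a zero    _  = ≤-reflexive (cong₂ (λ s r → y s + P r) (+-identityʳ a) (sym (+-identityʳ a)))
      ascend a (suc t) le = subst (λ s → y s + P a ≤ y a + P s) (sym (+-suc a t)) (begin
            y (suc (a + t)) + P a                  ≡⟨ cong (_+ P a) (step lt) ⟩
            x (next ((a + t) mod suc m′)) + P a    ≤⟨ +-monoˡ-≤ (P a) (up ((a + t) mod suc m′)) ⟩
            y (a + t) + d (a + t) + P a            ≡⟨ swap (y (a + t)) (d (a + t)) (P a) ⟩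
            y (a + t) + P a + d (a + t)            ≤⟨ +-monoˡ-≤ (d (a + t)) (ascend a t (<⇒≤ lt)) ⟩
            y a + P (a + t) + d (a + t)            ≡⟨ +-assoc (y a) _ _ ⟩
            y a + (P (a + t) + d (a + t))          ≡⟨ cong (y a +_) (∑-last (a + t) d) ⟨
            y a + P (suc (a + t))                  ∎)
        where
        open ≤-Reasoning
        swap : ∀ a b c → a + b + c ≡ a + c + b
        swap = solve-∀
        lt : a + t < suc m′
        lt = subst (_≤ suc m′) (+-suc a t) le
      P-total : P (suc m′) ≡ ∑ c
      P-total = ∑-cong (λ i → cong c (mod-toℕ i))
      P-zero : P 0 ≡ 0
      P-zero = ∑-zero {f = d ∘ toℕ {0}} (λ ())
      y-wraps : y (suc m′) ≡ y 0
      y-wraps = cong x (toℕ-injective (trans (toℕ-fromℕ< (m%n<n (suc m′) (suc m′))) (n%n≡0 (suc m′))))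
      descend′ : ∀ {a b} → a ≤ b → b ≤ suc m′ → y a + P a ≤ y b + P b
      descend′ {a} a≤b b≤ with m≤n⇒∃[o]m+o≡n a≤b
      ... | t , refl = descend a t b≤
      ascend′ : ∀ {a b} → a ≤ b → b ≤ suc m′ → y b + P a ≤ y a + P b
      ascend′ {a} a≤b b≤ with m≤n⇒∃[o]m+o≡n a≤b
      ... | t , refl = ascend a t b≤
      module _ (a b : ℕ) (a≤b : a ≤ b) (b≤ : b ≤ suc m′) where
        -- The direct arc costs P b minus P a, and the arc through 0 costs the rest of the total.
        -- Adding the two bounds gives the factor 2 and the full sum of `c`.
        forward : 2 * y a ≤ 2 * y b + ∑ c
        forward = subst (λ s → 2 * y a ≤ 2 * y b + s) P-total
          (linear (2 * y a) (2 * y b + P (suc m′)) 0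
            (identity (y a) (y b) (y 0) (P a) (P b) (P (suc m′)))
            (+-mono-≤ (descend′ a≤b b≤) (+-mono-≤
              (subst (λ s → s + P b ≤ y b + P (suc m′)) y-wraps (ascend′ b≤ ≤-refl))
              (subst (λ s → y a + s ≤ y 0 + P a) P-zero (ascend′ z≤n (≤-trans a≤b b≤))))))
          where
          identity : ∀ ya yb y0 Pa Pb Pm →
            2 * ya + ((yb + Pb) + ((yb + Pm) + (y0 + Pa))) + 0 ≡
            2 * yb + Pm + ((ya + Pa) + ((y0 + Pb) + (ya + 0)))
          identity = solve-∀
        backward : 2 * y b ≤ 2 * y a + ∑ c
        backward = subst (λ s → 2 * y b ≤ 2 * y a + s) P-total
          (linear (2 * y b) (2 * y a + P (suc m′)) 0
            (identity (y a) (y b) (y 0) (P a) (P b) (P (suc m′)))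
            (+-mono-≤ (ascend′ a≤b b≤) (+-mono-≤
              (subst (λ s → y b + P b ≤ s + P (suc m′)) y-wraps (descend′ b≤ ≤-refl))
              (subst (λ s → y 0 + s ≤ y a + P a) P-zero (descend′ z≤n (≤-trans a≤b b≤))))))
          where
          identity : ∀ ya yb y0 Pa Pb Pm →
            2 * yb + ((ya + Pb) + ((y0 + Pm) + (ya + Pa))) + 0 ≡
            2 * ya + Pm + ((yb + Pa) + ((yb + Pb) + (y0 + 0)))
          identity = solve-∀
      result : 2 * x p ≤ 2 * x q + ∑ c
      result with ≤-total (toℕ p) (toℕ q)
      ... | inj₁ p≤q = subst₂ (λ s r → 2 * x s ≤ 2 * x r + ∑ c) (mod-toℕ p) (mod-toℕ q)
                         (forward (toℕ p) (toℕ q) p≤q (<⇒≤ (toℕ<n q)))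
      ... | inj₂ q≤p = subst₂ (λ s r → 2 * x s ≤ 2 * x r + ∑ c) (mod-toℕ p) (mod-toℕ q)
                         (backward (toℕ q) (toℕ p) q≤p (<⇒≤ (toℕ<n p)))

-- Layers of a vertex set of the join

∑-const : (a : ℕ) → ∑ {m} (λ _ → a) ≡ m * a
∑-const {zero}  a = ∑-zero {f = λ _ → a} (λ ())
∑-const {suc m} a = trans (∑-suc {m} (λ _ → a)) (cong (a +_) (∑-const {m} a))

∑-split : (m : ℕ) (f : Fin (m + n) → ℕ) → ∑ f ≡ ∑[ i ] f (i ↑ˡ n) + ∑[ j ] f (m ↑ʳ j)
∑-split {n} zero f = cong (_+ ∑ f) (sym (∑-zero {f = λ i → f (i ↑ˡ n)} (λ ())))
∑-split {n} (suc m) f = begin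
  ∑ f
    ≡⟨ ∑-suc f ⟩
  f zero + ∑[ i ] f (suc i)
    ≡⟨ cong (f zero +_) (∑-split m (λ i → f (suc i))) ⟩
  f zero + (∑[ i ] f (suc (i ↑ˡ n)) + ∑[ j ] f (suc m ↑ʳ j))
    ≡⟨ +-assoc (f zero) _ _ ⟨
  f zero + ∑[ i ] f (suc (i ↑ˡ n)) + ∑[ j ] f (suc m ↑ʳ j)
    ≡⟨ cong (_+ ∑[ j ] f (suc m ↑ʳ j)) (∑-suc (λ i → f (i ↑ˡ n))) ⟨
  ∑[ i ] f (i ↑ˡ n) + ∑[ j ] f (suc m ↑ʳ j) ∎
  where open ≡-Reasoning

∑-combine : (m : ℕ) (f : Fin (m * n) → ℕ) → ∑ f ≡ ∑ {m} (λ i → ∑ {n} (λ u → f (combine i u)))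
∑-combine zero f = trans (∑-zero {f = f} (λ ())) (sym (∑-zero {0} (λ ())))
∑-combine {n} (suc m) f = begin
  ∑ f
    ≡⟨ ∑-split n f ⟩
  ∑[ u ] f (u ↑ˡ (m * n)) + ∑[ q ] f (n ↑ʳ q)
    ≡⟨ cong (∑[ u ] f (u ↑ˡ (m * n)) +_) (∑-combine m (λ q → f (n ↑ʳ q))) ⟩
  ∑[ u ] f (u ↑ˡ (m * n)) + ∑ {m} (λ i → ∑ {n} (λ u → f (n ↑ʳ combine i u)))
    ≡⟨ ∑-suc (λ i → ∑ {n} (λ u → f (combine i u))) ⟨
  ∑ {suc m} (λ i → ∑ {n} (λ u → f (combine i u))) ∎
  where open ≡-Reasoning

layer : Subset (m * n) → Fin m → Subset n
layer X i = tabulate (λ u → lookup X (combine i u))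

χ-layer : (X : Subset (m * n)) (i : Fin m) (u : Fin n) → χ (layer X i) u ≡ χ X (combine i u)
χ-layer X i u = 𝟙-cong (u ∈? layer X i) (combine i u ∈? X)
  (λ p → lookup⇒[]= (combine i u) X (trans (sym (lookup∘tabulate _ u)) ([]=⇒lookup p)))
  (λ p → lookup⇒[]= u (layer X i) (trans (lookup∘tabulate _ u) ([]=⇒lookup p)))

χ∁-layer : (X : Subset (m * n)) (i : Fin m) (u : Fin n) → χ (∁ (layer X i)) u ≡ χ (∁ X) (combine i u)
χ∁-layer X i u = +-cancelˡ-≡ (χ (layer X i) u) _ _ (trans (χ+χ∁ (layer X i) u)
  (trans (sym (χ+χ∁ X (combine i u))) (cong (_+ χ (∁ X) (combine i u)) (sym (χ-layer X i u)))))

∣layer∣ : (X : Subset (m * n)) (i : Fin m) → ∣ layer X i ∣ ≡ ∑[ u ] χ X (combine i u)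
∣layer∣ X i = trans (sym (∑χ (layer X i))) (∑-cong (χ-layer X i))

∑∣layer∣ : (X : Subset (m * n)) → ∑[ i ] ∣ layer {m} X i ∣ ≡ ∣ X ∣
∑∣layer∣ {m} X = trans (∑-cong (∣layer∣ {m} X)) (trans (sym (∑-combine m (χ X))) (∑χ X))

∣layer∣+∣layer∁∣ : (X : Subset (m * n)) (i : Fin m) → ∣ layer X i ∣ + ∣ layer (∁ X) i ∣ ≡ n
∣layer∣+∣layer∁∣ {n = n} X i = begin
  ∣ layer X i ∣ + ∣ layer (∁ X) i ∣
    ≡⟨ cong₂ _+_ (∣layer∣ X i) (∣layer∣ (∁ X) i) ⟩
  ∑[ u ] χ X (combine i u) + ∑[ u ] χ (∁ X) (combine i u)
    ≡⟨ ∑-+ (λ u → χ X (combine i u)) (λ u → χ (∁ X) (combine i u)) ⟨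
  ∑[ u ] (χ X (combine i u) + χ (∁ X) (combine i u))
    ≡⟨ ∑-cong (λ u → χ+χ∁ X (combine i u)) ⟩
  ∑ {n} (λ _ → 1)
    ≡⟨ trans (∑-const {n} 1) (*-identityʳ n) ⟩
  n ∎
  where open ≡-Reasoning

∣X∣>0⇒member : (X : Subset n) → 0 < ∣ X ∣ → ∃[ u ] u ∈ X
∣X∣>0⇒member X lt with ∣ X ∣ in eq
... | suc j with pick X eq
... | x , Y , _ , _ , refl = x , x∈p∪q⁺ (inj₁ (x∈⁅x⁆ x))

-- Triangles, degrees and boundaries in the join

module _ {m n : ℕ} (4≤m : 4 ≤ m) (G : Fin m → Graph n) (M : Fin m → Permutation′ n) where

  private
    3≤m : 3 ≤ m
    3≤m = <⇒≤ 4≤m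

    Γ : Graph (m * n)
    Γ = cyclicJoin 3≤m G M

    split : Fin (m * n) → Fin m × Fin n
    split = remQuot n

    column : Fin (m * n) → Fin m
    column p = proj₁ (split p)

    row : Fin (m * n) → Fin n
    row p = proj₂ (split p)

  -- If `r` shares the layer of `p`, either the matching sends two vertices to `q` or the cycle
  -- closes after one or two steps. If `r` is matched forward to `p`, it closes after one, two or
  -- three steps. If `p` is matched forward to `r`, then `r` is `q`.
  matched-no-triangle : ∀ {p q r} → Matched G M p q → CycAdj G M r p → ¬ CycAdj G M r q
  matched-no-triangle {i , u} {_} {j , v} (refl , refl) (inj₁ (refl , vu)) (inj₁ (e , _)) = next≢ 3≤m i (sym e)
  matched-no-triangle {i , u} {_} {j , v} (refl , refl) (inj₁ (refl , vu)) (inj₂ (inj₁ (_ , e))) =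
    adj-≢ (G i) vu (trans (sym (inverseˡ (M i))) (trans (cong (M i ⟨$⟩ˡ_) (sym e)) (inverseˡ (M i))))
  matched-no-triangle {i , u} {_} {j , v} (refl , refl) (inj₁ (refl , vu)) (inj₂ (inj₂ (e , _))) = next²≢ 3≤m i (sym e)
  matched-no-triangle {_} {_} {j , v} (refl , refl) (inj₂ (inj₁ (refl , refl))) (inj₁ (e , _)) = next²≢ 3≤m j (sym e)
  matched-no-triangle {_} {_} {j , v} (refl , refl) (inj₂ (inj₁ (refl , refl))) (inj₂ (inj₁ (e , _))) = next≢ 3≤m (next j) e
  matched-no-triangle {_} {_} {j , v} (refl , refl) (inj₂ (inj₁ (refl , refl))) (inj₂ (inj₂ (e , _))) = next³≢ 4≤m j (sym e)
  matched-no-triangle {p} {q} (refl , refl) (inj₂ (inj₂ (refl , refl))) rq = cycAdj-irrefl G M 3≤m q rq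

  join-triangleFree : (∀ i → TriangleFree (G i)) → TriangleFree Γ
  join-triangleFree tf p q r (pq , qr , pr) = triangle (split p) (split q) (split r) pq qr pr
    where
    ~ : ∀ {a b} → CycAdj G M a b → CycAdj G M b a
    ~ = cycAdj-sym G M
    triangle : ∀ a b c → CycAdj G M a b → CycAdj G M b c → ¬ CycAdj G M a c
    triangle a b c (inj₂ (inj₁ ab)) bc ac = matched-no-triangle ab (~ ac) (~ bc)
    triangle a b c (inj₂ (inj₂ ba)) bc ac = matched-no-triangle ba (~ bc) (~ ac)
    triangle a b c ab@(inj₁ _) (inj₂ (inj₁ bc)) ac = matched-no-triangle bc ab ac
    triangle a b c ab@(inj₁ _) (inj₂ (inj₂ cb)) ac = matched-no-triangle cb ac ab
    triangle a b c ab@(inj₁ _) bc@(inj₁ _) (inj₂ (inj₁ ac)) = matched-no-triangle ac (~ ab) bc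
    triangle a b c ab@(inj₁ _) bc@(inj₁ _) (inj₂ (inj₂ ca)) = matched-no-triangle ca bc (~ ab)
    triangle (i , u) (_ , v) (_ , w) (inj₁ (refl , uv)) (inj₁ (refl , vw)) (inj₁ (_ , uw)) = tf i u v w (uv , vw , uw)

  private
    forth back : Fin m × Fin n → Fin m × Fin n
    forth (i , u) = next i , M i ⟨$⟩ʳ u
    back  (j , v) = prev j , M (prev j) ⟨$⟩ˡ v

    forth-back : ∀ p → forth (back p) ≡ p
    forth-back (j , v) = cong₂ _,_ (next-prev j) (inverseʳ (M (prev j)))

    back-forth : ∀ p → back (forth p) ≡ p
    back-forth (i , u) = trans (cong (λ t → t , M t ⟨$⟩ˡ (M i ⟨$⟩ʳ u)) (prev-next i))
      (cong (i ,_) (inverseˡ (M i)))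

    conjugate : (Fin m × Fin n → Fin m × Fin n) → Fin (m * n) → Fin (m * n)
    conjugate f p = uncurry combine (f (split p))

    conjugate-inverse : (f g : Fin m × Fin n → Fin m × Fin n) → (∀ p → f (g p) ≡ p) →
                        ∀ p → conjugate f (conjugate g p) ≡ p
    conjugate-inverse f g fg p = trans (cong (uncurry combine ∘ f)
      (remQuot-combine (proj₁ (g (split p))) (proj₂ (g (split p)))))
      (trans (cong (uncurry combine) (fg (split p))) (combine-remQuot {m} n p))

  -- One step forward along the matchings. The neighbours of a vertex outside its layer are its
  -- image and its preimage under `σ`.
  σ : Permutation′ (m * n)
  σ = permutation (conjugate forth) (conjugate back)
    (conjugate-inverse forth back forth-back) (conjugate-inverse back forth back-forth)

  private
    same-layer? : ∀ (a b : Fin m × Fin n) → Dec (proj₁ a ≡ proj₁ b × Adj (G (proj₁ a)) (proj₂ a) (proj₂ b))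
    same-layer? (i , u) (j , v) = (i ≟ᶠ j) ×-dec adj? (G i) u v

    matched? : ∀ a b → Dec (Matched G M a b)
    matched? (i , u) (j , v) = (j ≟ᶠ next i) ×-dec (v ≟ᶠ M i ⟨$⟩ʳ u)

    -- The three kinds of adjacency exclude one another because one or two steps around the cycle
    -- never return; hence the indicators add up.
    𝟙-cycAdj : ∀ a b → 𝟙 (cycAdj? G M a b) ≡ 𝟙 (same-layer? a b) + (𝟙 (matched? a b) + 𝟙 (matched? b a))
    𝟙-cycAdj a b = trans
      (𝟙-⊎ (same-layer? a b) (matched? a b ⊎-dec matched? b a) (layer-or-matching a b))
      (cong (𝟙 (same-layer? a b) +_) (𝟙-⊎ (matched? a b) (matched? b a) (one-direction a b)))
      where
      layer-or-matching : ∀ a b → ¬ ((proj₁ a ≡ proj₁ b × Adj (G (proj₁ a)) (proj₂ a) (proj₂ b)) ×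
                                     (Matched G M a b ⊎ Matched G M b a))
      layer-or-matching (i , _) _ ((refl , _) , inj₁ (e , _)) = next≢ 3≤m i (sym e)
      layer-or-matching (i , _) _ ((refl , _) , inj₂ (e , _)) = next≢ 3≤m i (sym e)
      one-direction : ∀ a b → ¬ (Matched G M a b × Matched G M b a)
      one-direction (i , _) _ ((refl , _) , (e , _)) = next²≢ 3≤m i (sym e)

    remQuot-injective : ∀ {p q} → split p ≡ split q → p ≡ q
    remQuot-injective {p} {q} eq = trans (sym (combine-remQuot {m} n p))
      (trans (cong (uncurry combine) eq) (combine-remQuot {m} n q))

    remQuot-σ : ∀ p → split (σ ⟨$⟩ʳ p) ≡ forth (split p)
    remQuot-σ p = remQuot-combine (proj₁ (forth (split p))) (proj₂ (forth (split p)))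

    𝟙-matched : ∀ p q → 𝟙 (matched? (split p) (split q)) ≡ 𝟙 (q ≟ᶠ σ ⟨$⟩ʳ p)
    𝟙-matched p q = 𝟙-cong (matched? (split p) (split q)) (q ≟ᶠ σ ⟨$⟩ʳ p)
      (λ (e , e′) → remQuot-injective (trans (cong₂ _,_ e e′) (sym (remQuot-σ p))))
      (λ { refl → cong proj₁ (remQuot-σ p) , cong proj₂ (remQuot-σ p) })

    -- 𝟙 (p ≟ σ q) is 𝟙 (q ≟ σ⁻¹ p), so both matching edges at p are sums over a
    -- single vertex.

    𝟙-matched⁻ : ∀ p q → 𝟙 (matched? (split q) (split p)) ≡ 𝟙 (q ≟ᶠ σ ⟨$⟩ˡ p)
    𝟙-matched⁻ p q = trans (𝟙-matched q p) (𝟙-cong (p ≟ᶠ σ ⟨$⟩ʳ q) (q ≟ᶠ σ ⟨$⟩ˡ p)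
      (λ { refl → sym (inverseˡ σ) }) (λ { refl → sym (inverseʳ σ) }))

    nbr-layer : (g : Fin (m * n) → ℕ) (p : Fin (m * n)) →
      ∑[ q ] (g q * 𝟙 (same-layer? (split p) (split q))) ≡
      nbr (G (column p)) (λ v → g (combine (column p) v)) (row p)
    nbr-layer g p = begin
      ∑[ q ] (g q * 𝟙 (same-layer? (i , u) (split q)))
        ≡⟨ ∑-combine m (λ q → g q * 𝟙 (same-layer? (i , u) (split q))) ⟩
      ∑[ j ] (∑[ v ] (g (combine j v) * 𝟙 (same-layer? (i , u) (split (combine j v)))))
        ≡⟨ ∑-cong (λ j → ∑-cong (λ v → cong (λ t → g (combine j v) * 𝟙 (same-layer? (i , u) t)) (remQuot-combine j v))) ⟩
      ∑[ j ] (∑[ v ] (g (combine j v) * 𝟙 (same-layer? (i , u) (j , v))))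
        ≡⟨ ∑-cong (λ j → trans (∑-cong (λ v → rearrange j v))
             (∑-*ʳ (𝟙 (j ≟ᶠ i)) (λ v → g (combine j v) * 𝟙 (adj? (G i) u v)))) ⟩
      ∑[ j ] (∑[ v ] (g (combine j v) * 𝟙 (adj? (G i) u v)) * 𝟙 (j ≟ᶠ i))
        ≡⟨ ∑-select (λ j → ∑[ v ] (g (combine j v) * 𝟙 (adj? (G i) u v))) i ⟩
      ∑[ v ] (g (combine i v) * 𝟙 (adj? (G i) u v))
        ≡⟨ nbr-def (G i) (λ v → g (combine i v)) u ⟨
      nbr (G i) (λ v → g (combine i v)) u ∎
      where
      open ≡-Reasoning
      i = column p
      u = row p
      rearrange : ∀ j v → g (combine j v) * 𝟙 (same-layer? (i , u) (j , v)) ≡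
                          g (combine j v) * 𝟙 (adj? (G i) u v) * 𝟙 (j ≟ᶠ i)
      rearrange j v = trans (cong (g (combine j v) *_) (trans (𝟙-× (i ≟ᶠ j) (adj? (G i) u v))
        (trans (*-comm (𝟙 (i ≟ᶠ j)) _) (cong (𝟙 (adj? (G i) u v) *_) (𝟙-cong (i ≟ᶠ j) (j ≟ᶠ i) sym sym)))))
        (sym (*-assoc (g (combine j v)) _ _))

  nbr-join : (g : Fin (m * n) → ℕ) (p : Fin (m * n)) → nbr Γ g p ≡
    nbr (G (column p)) (λ v → g (combine (column p) v)) (row p) +
    (g (σ ⟨$⟩ʳ p) + g (σ ⟨$⟩ˡ p))
  nbr-join g p = begin
    nbr Γ g p
      ≡⟨ nbr-def Γ g p ⟩
    ∑[ q ] (g q * 𝟙 (adj? Γ p q))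
      ≡⟨ ∑-cong expand ⟩
    ∑[ q ] (S q + (g q * 𝟙 (q ≟ᶠ σ ⟨$⟩ʳ p) + g q * 𝟙 (q ≟ᶠ σ ⟨$⟩ˡ p)))
      ≡⟨ ∑-+ S (λ q → g q * 𝟙 (q ≟ᶠ σ ⟨$⟩ʳ p) + g q * 𝟙 (q ≟ᶠ σ ⟨$⟩ˡ p)) ⟩
    ∑ S + ∑[ q ] (g q * 𝟙 (q ≟ᶠ σ ⟨$⟩ʳ p) + g q * 𝟙 (q ≟ᶠ σ ⟨$⟩ˡ p))
      ≡⟨ cong₂ _+_ (nbr-layer g p) (trans
           (∑-+ (λ q → g q * 𝟙 (q ≟ᶠ σ ⟨$⟩ʳ p)) (λ q → g q * 𝟙 (q ≟ᶠ σ ⟨$⟩ˡ p)))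
           (cong₂ _+_ (∑-select g (σ ⟨$⟩ʳ p)) (∑-select g (σ ⟨$⟩ˡ p)))) ⟩
    _ ∎
    where
    open ≡-Reasoning
    S : Fin (m * n) → ℕ
    S q = g q * 𝟙 (same-layer? (split p) (split q))
    expand : ∀ q → g q * 𝟙 (adj? Γ p q) ≡ S q + (g q * 𝟙 (q ≟ᶠ σ ⟨$⟩ʳ p) + g q * 𝟙 (q ≟ᶠ σ ⟨$⟩ˡ p))
    expand q = begin
      g q * 𝟙 (adj? Γ p q)
        ≡⟨ cong (g q *_) (trans (𝟙-cycAdj (split p) (split q))
             (cong (𝟙 (same-layer? (split p) (split q)) +_) (cong₂ _+_ (𝟙-matched p q) (𝟙-matched⁻ p q)))) ⟩
      g q * (𝟙 (same-layer? (split p) (split q)) + (𝟙 (q ≟ᶠ σ ⟨$⟩ʳ p) + 𝟙 (q ≟ᶠ σ ⟨$⟩ˡ p)))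
        ≡⟨ *-distribˡ-+ (g q) _ _ ⟩
      S q + g q * (𝟙 (q ≟ᶠ σ ⟨$⟩ʳ p) + 𝟙 (q ≟ᶠ σ ⟨$⟩ˡ p))
        ≡⟨ cong (S q +_) (*-distribˡ-+ (g q) _ _) ⟩
      S q + (g q * 𝟙 (q ≟ᶠ σ ⟨$⟩ʳ p) + g q * 𝟙 (q ≟ᶠ σ ⟨$⟩ˡ p)) ∎

  join-regular : ∀ {k} → (∀ i → Regular k (G i)) → Regular (k + 2) Γ
  join-regular {k} reg p = trans (sym (nbr-one Γ p)) (trans (nbr-join (λ _ → 1) p)
    (cong (_+ 2) (trans (nbr-one (G i) u) (reg i u))))
    where
    i = column p
    u = row p

  -- Indicates that the matching edge from `p` to its image under `σ` crosses the boundary, in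
  -- either direction; at most one summand is 1.
  switches : Subset (m * n) → Fin (m * n) → ℕ
  switches X p = χ X p * χ (∁ X) (σ ⟨$⟩ʳ p) + χ X (σ ⟨$⟩ʳ p) * χ (∁ X) p

  crossing : Subset (m * n) → Fin m → ℕ
  crossing X i = ∑[ u ] switches X (combine i u)

  boundary-join : (X : Subset (m * n)) →
    boundary Γ X ≡ ∑[ i ] boundary (G i) (layer X i) + ∑[ i ] crossing X i
  boundary-join X = begin
    boundary Γ X
      ≡⟨ boundary≡pairs Γ X ⟩
    pairs Γ (χ X) (χ (∁ X))
      ≡⟨ pairs-def Γ (χ X) (χ (∁ X)) ⟩
    ∑[ p ] (χ X p * nbr Γ (χ (∁ X)) p)
      ≡⟨ ∑-cong (λ p → trans (cong (χ X p *_) (nbr-join (χ (∁ X)) p)) (distribute (χ X p) (L p) _ _)) ⟩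
    ∑[ p ] (χ X p * L p + (χ X p * χ (∁ X) (σ ⟨$⟩ʳ p) + χ X p * χ (∁ X) (σ ⟨$⟩ˡ p)))
      ≡⟨ ∑-+ (λ p → χ X p * L p) (λ p → χ X p * χ (∁ X) (σ ⟨$⟩ʳ p) + χ X p * χ (∁ X) (σ ⟨$⟩ˡ p)) ⟩
    ∑[ p ] (χ X p * L p) + ∑[ p ] (χ X p * χ (∁ X) (σ ⟨$⟩ʳ p) + χ X p * χ (∁ X) (σ ⟨$⟩ˡ p))
      ≡⟨ cong₂ _+_ layers matching ⟩
    ∑[ i ] boundary (G i) (layer X i) + ∑[ i ] crossing X i ∎
    where
    open ≡-Reasoning
    L : Fin (m * n) → ℕ
    L p = nbr (G (column p)) (λ v → χ (∁ X) (combine (column p) v)) (row p)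
    distribute : ∀ a l b c → a * (l + (b + c)) ≡ a * l + (a * b + a * c)
    distribute = solve-∀
    layers : ∑[ p ] (χ X p * L p) ≡ ∑[ i ] boundary (G i) (layer X i)
    layers = begin
      ∑[ p ] (χ X p * L p)
        ≡⟨ ∑-combine m (λ p → χ X p * L p) ⟩
      ∑[ i ] (∑[ u ] (χ X (combine i u) * L (combine i u)))
        ≡⟨ ∑-cong (λ i → ∑-cong (λ u → cong₂ _*_ (sym (χ-layer X i u)) (at-layer i u))) ⟩
      ∑[ i ] (∑[ u ] (χ (layer X i) u * nbr (G i) (χ (∁ (layer X i))) u))
        ≡⟨ ∑-cong (λ i → trans (sym (pairs-def (G i) (χ (layer X i)) (χ (∁ (layer X i)))))
             (sym (boundary≡pairs (G i) (layer X i)))) ⟩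
      ∑[ i ] boundary (G i) (layer X i) ∎
      where
      at-layer : ∀ i u → L (combine i u) ≡ nbr (G i) (χ (∁ (layer X i))) u
      at-layer i u = trans
        (cong (λ t → nbr (G (proj₁ t)) (λ v → χ (∁ X) (combine (proj₁ t) v)) (proj₂ t)) (remQuot-combine i u))
        (nbr-cong (G i) (λ v → sym (χ∁-layer X i v)) u)
    -- Reindexing by `σ` charges an edge seen from its head to its tail, that is, to the layer where
    -- it starts.
    back-edges : ∑[ p ] (χ X p * χ (∁ X) (σ ⟨$⟩ˡ p)) ≡ ∑[ p ] (χ X (σ ⟨$⟩ʳ p) * χ (∁ X) p)
    back-edges = trans (∑-permutation (λ p → χ X p * χ (∁ X) (σ ⟨$⟩ˡ p)) σ)
      (∑-cong (λ p → cong (λ t → χ X (σ ⟨$⟩ʳ p) * χ (∁ X) t) (inverseˡ σ)))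
    matching : ∑[ p ] (χ X p * χ (∁ X) (σ ⟨$⟩ʳ p) + χ X p * χ (∁ X) (σ ⟨$⟩ˡ p)) ≡ ∑[ i ] crossing X i
    matching = begin
      ∑[ p ] (χ X p * χ (∁ X) (σ ⟨$⟩ʳ p) + χ X p * χ (∁ X) (σ ⟨$⟩ˡ p))
        ≡⟨ ∑-+ (λ p → χ X p * χ (∁ X) (σ ⟨$⟩ʳ p)) (λ p → χ X p * χ (∁ X) (σ ⟨$⟩ˡ p)) ⟩
      ∑[ p ] (χ X p * χ (∁ X) (σ ⟨$⟩ʳ p)) + ∑[ p ] (χ X p * χ (∁ X) (σ ⟨$⟩ˡ p))
        ≡⟨ cong (∑[ p ] (χ X p * χ (∁ X) (σ ⟨$⟩ʳ p)) +_) back-edges ⟩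
      ∑[ p ] (χ X p * χ (∁ X) (σ ⟨$⟩ʳ p)) + ∑[ p ] (χ X (σ ⟨$⟩ʳ p) * χ (∁ X) p)
        ≡⟨ ∑-+ (λ p → χ X p * χ (∁ X) (σ ⟨$⟩ʳ p)) (λ p → χ X (σ ⟨$⟩ʳ p) * χ (∁ X) p) ⟨
      ∑ (switches X)
        ≡⟨ ∑-combine m (switches X) ⟩
      ∑[ i ] crossing X i ∎

  private
    ∣layer-next∣ : (X : Subset (m * n)) (i : Fin m) → ∣ layer X (next i) ∣ ≡ ∑[ u ] χ X (σ ⟨$⟩ʳ combine i u)
    ∣layer-next∣ X i = trans (∣layer∣ X (next i)) (trans (∑-permutation (λ v → χ X (combine (next i) v)) (M i))
      (∑-cong (λ u → cong (λ t → χ X (uncurry combine (forth t))) (sym (remQuot-combine i u)))))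

    χ-change : (X : Subset (m * n)) (p q : Fin (m * n)) →
               χ X p ≤ χ X q + χ X p * χ (∁ X) q
    χ-change X p q = ≤-trans (≤-reflexive (sym (trans (cong (χ X p *_) (χ+χ∁ X q)) (*-identityʳ (χ X p)))))
      (≤-trans (≤-reflexive (*-distribˡ-+ (χ X p) (χ X q) (χ (∁ X) q)))
        (+-monoˡ-≤ (χ X p * χ (∁ X) q) (≤-trans (*-monoˡ-≤ (χ X q) (𝟙≤1 (p ∈? X))) (≤-reflexive (*-identityˡ _)))))

  -- Vertices of `X` in this layer are matched either into `X` or across the boundary. Together with
  -- `layer-up` this supplies the hypotheses of `variation`.
  layer-down : (X : Subset (m * n)) (i : Fin m) → ∣ layer X i ∣ ≤ ∣ layer X (next i) ∣ + crossing X i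
  layer-down X i = begin
    ∣ layer X i ∣
      ≡⟨ ∣layer∣ X i ⟩
    ∑[ u ] χ X (combine i u)
      ≤⟨ ∑-mono (λ u → ≤-trans (χ-change X (combine i u) (σ ⟨$⟩ʳ combine i u))
           (+-monoʳ-≤ (χ X (σ ⟨$⟩ʳ combine i u)) (m≤m+n _ _))) ⟩
    ∑[ u ] (χ X (σ ⟨$⟩ʳ combine i u) + switches X (combine i u))
      ≡⟨ ∑-+ (λ u → χ X (σ ⟨$⟩ʳ combine i u)) (λ u → switches X (combine i u)) ⟩
    ∑[ u ] χ X (σ ⟨$⟩ʳ combine i u) + crossing X i
      ≡⟨ cong (_+ crossing X i) (∣layer-next∣ X i) ⟨
    ∣ layer X (next i) ∣ + crossing X i ∎
    where open ≤-Reasoning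

  layer-up : (X : Subset (m * n)) (i : Fin m) → ∣ layer X (next i) ∣ ≤ ∣ layer X i ∣ + crossing X i
  layer-up X i = begin
    ∣ layer X (next i) ∣
      ≡⟨ ∣layer-next∣ X i ⟩
    ∑[ u ] χ X (σ ⟨$⟩ʳ combine i u)
      ≤⟨ ∑-mono (λ u → ≤-trans (χ-change X (σ ⟨$⟩ʳ combine i u) (combine i u))
           (+-monoʳ-≤ (χ X (combine i u)) (m≤n+m _ _))) ⟩
    ∑[ u ] (χ X (combine i u) + switches X (combine i u))
      ≡⟨ ∑-+ (λ u → χ X (combine i u)) (λ u → switches X (combine i u)) ⟩
    ∑[ u ] χ X (combine i u) + crossing X i
      ≡⟨ cong (_+ crossing X i) (∣layer∣ X i) ⟨
    ∣ layer X i ∣ + crossing X i ∎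
    where open ≤-Reasoning

-- For 4 ≤ ∣X∣ ≤ 2k the density bound is a concave quadratic in ∣X∣, which takes
-- the value 4k at both ends.

small-boundary : ∀ {N k} → 3 ≤ k → (G : Graph N) → Regular (k + 2) G → TriangleFree G →
                 (X : Subset N) → 4 ≤ ∣ X ∣ → ∣ X ∣ ≤ 2 * k → 3 * k + 3 ≤ boundary G X
small-boundary {k = k} 3≤k G reg tf X 4≤ ≤2k with m≤n⇒∃[o]m+o≡n 4≤ | m≤n⇒∃[o]m+o≡n ≤2k
-- With ∣X∣ = 4+y and 2k = 4+y+z the doubled bound factors as (4+y)(4+z) = 8k + yz, so `y * z` is
-- the slack.
... | y , x≡ | z , 2k≡ = *-cancelˡ-≤ 2 (subst (_≤ 2 * boundary G X) (sym (identity₁ k))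
    (subst (λ t → 3 * t + 6 ≤ 2 * boundary G X) 4+y+z (linear (3 * (4 + y + z) + 6) (2 * boundary G X) (y * z)
      (identity₂ y z (boundary G X)) (+-mono-≤ bound 2≤y+z))))
  where
  4+y+z : 4 + y + z ≡ 2 * k
  4+y+z = trans (cong (_+ z) x≡) 2k≡
  identity₁ : ∀ k → 2 * (3 * k + 3) ≡ 3 * (2 * k) + 6
  identity₁ = solve-∀
  identity₂ : ∀ y z b → 3 * (4 + y + z) + 6 + ((2 * b + (4 + y) * (4 + y)) + (y + z)) + y * z ≡
              2 * b + ((4 + y + z + 4) * (4 + y) + 2)
  identity₂ = solve-∀
  identity₃ : ∀ k x → 2 * ((k + 2) * x) ≡ (2 * k + 4) * x
  identity₃ = solve-∀
  bound : (4 + y + z + 4) * (4 + y) ≤ 2 * boundary G X + (4 + y) * (4 + y)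
  bound = subst₂ (λ t x → (t + 4) * x ≤ 2 * boundary G X + x * x) (sym 4+y+z) (sym x≡)
    (subst (_≤ 2 * boundary G X + ∣ X ∣ * ∣ X ∣) (identity₃ k ∣ X ∣) (density G reg tf X))
  2≤y+z : 2 ≤ y + z
  2≤y+z = +-cancelˡ-≤ 4 2 (y + z) (≤-trans (*-monoʳ-≤ 2 3≤k)
    (≤-reflexive (trans (sym 4+y+z) (+-assoc 4 y z))))

-- P counts the layers that X meets, s bounds 2∣Xᵢ∣ for each layer.

few-layers : ∀ P k s x → 3 ≤ k → 4 ≤ x → 2 * k < x → 2 * x ≤ P * s → 3 * k + 3 ≤ P * k + s
few-layers 0 k s x 3≤k 4≤x 2k<x le = contradiction (≤-trans (*-monoʳ-≤ 2 4≤x) le) (λ ())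
-- One layer gives s ≥ 2x and two layers give s ≥ x, where x is at least 2k+1.
few-layers 1 k s x 3≤k 4≤x 2k<x le = linear (3 * k + 3) (1 * k + s) (k + 2) (identity k s x)
    (+-mono-≤ le (+-mono-≤ 2k<x (+-mono-≤ 2k<x 3≤k)))
  where
  identity : ∀ k s x → 3 * k + 3 + (1 * s + (x + (x + k))) + (k + 2) ≡
             1 * k + s + (2 * x + (suc (2 * k) + (suc (2 * k) + 3)))
  identity = solve-∀
few-layers 2 k s x 3≤k 4≤x 2k<x le = *-cancelˡ-≤ 2 (linear (2 * (3 * k + 3)) (2 * (2 * k + s)) 2 (identity k s x)
    (+-mono-≤ le (+-mono-≤ 2k<x (+-mono-≤ 2k<x (+-mono-≤ 3≤k 3≤k)))))
  where
  identity : ∀ k s x → 2 * (3 * k + 3) + (2 * s + (x + (x + (k + k)))) + 2 ≡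
             2 * (2 * k + s) + (2 * x + (suc (2 * k) + (suc (2 * k) + (3 + 3))))
  identity = solve-∀
-- Here 3s ≥ 2x ≥ 8 forces s ≥ 3, all that 3k lacks.
few-layers 3 k s x 3≤k 4≤x 2k<x le = +-monoʳ-≤ (3 * k) (≮⇒≥ (λ s<3 → contradiction
  (≤-trans (*-monoʳ-≤ 2 4≤x) (≤-trans le (*-monoʳ-≤ 3 (s≤s⁻¹ s<3)))) (<⇒≱ (s≤s (s≤s (s≤s (s≤s (s≤s (s≤s (s≤s z≤n))))))))))
few-layers (suc (suc (suc (suc P)))) k s x 3≤k 4≤x 2k<x le = begin
  3 * k + 3                        ≤⟨ +-monoʳ-≤ (3 * k) 3≤k ⟩
  3 * k + k                        ≡⟨ +-comm (3 * k) k ⟩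
  4 * k                            ≤⟨ *-monoˡ-≤ k (m≤m+n 4 P) ⟩
  (4 + P) * k                      ≤⟨ m≤m+n ((4 + P) * k) s ⟩
  (4 + P) * k + s                  ∎
  where open ≤-Reasoning

-- The boundary of large sets in the join

module _ {m k n : ℕ} (4≤m : 4 ≤ m) (3≤k : 3 ≤ k) (G : Fin m → Graph n)
         (reg : ∀ i → Regular k (G i)) (conn : ∀ i → EdgeConnected k (G i))
         (tf : ∀ i → TriangleFree (G i)) (big : ⌈ 3 * k + 2 /2⌉ < n) (M : Fin m → Permutation′ n) where

  private
    Γ : Graph (m * n)
    Γ = cyclicJoin (<⇒≤ 4≤m) G M

    layer-boundary : (X : Subset (m * n)) (i : Fin m) → 0 < ∣ layer X i ∣ → ∣ layer X i ∣ < n →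
                     k ≤ boundary (G i) (layer X i)
    layer-boundary X i nonempty proper with ∣X∣>0⇒member (layer X i) nonempty
      | ∣X∣>0⇒member (∁ (layer X i)) (subst (0 <_) (sym (∣∁p∣≡n∸∣p∣ (layer X i))) (m<n⇒0<n∸m proper))
    ... | u , u∈ | v , v∈∁ = edgeConnected⇒boundary k (G i) (conn i) (layer X i) u∈ (x∈∁p⇒x∉p v∈∁)

    variation-from : (X : Subset (m * n)) (p q : Fin m) →
                     2 * ∣ layer X p ∣ ≤ 2 * ∣ layer X q ∣ + ∑ (crossing 4≤m G M X)
    variation-from X = variation (λ i → ∣ layer X i ∣) (crossing 4≤m G M X)
      (layer-down 4≤m G M X) (layer-up 4≤m G M X)

    -- Let `s` count the crossing matching edges. Comparison with the empty layer gives 2∣Xᵢ∣ ≤ s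
    -- for every i, and summing over the nonempty layers gives the hypothesis 2∣X∣ ≤ P s of
    -- `few-layers`. Each nonempty layer is cut properly and adds k.
    no-full-layer : (X : Subset (m * n)) → 4 ≤ ∣ X ∣ → (q : Fin m) → ∣ layer X q ∣ ≡ 0 →
                    (∀ i → ∣ layer X i ∣ < n) → 3 * k + 3 ≤ boundary Γ X
    no-full-layer X 4≤ q empty proper with ∣ X ∣ ≤? 2 * k
    ... | yes ≤2k = small-boundary 3≤k Γ (join-regular 4≤m G M reg) (join-triangleFree 4≤m G M tf) X 4≤ ≤2k
    ... | no ≰2k  = begin
      3 * k + 3
        ≤⟨ few-layers (∑ z) k s ∣ X ∣ 3≤k 4≤ (≰⇒> ≰2k) total ⟩
      ∑ z * k + s
        ≡⟨ cong (_+ s) (∑-*ʳ k z) ⟨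
      ∑[ i ] (z i * k) + s
        ≤⟨ +-monoˡ-≤ s (∑-mono layer≥) ⟩
      ∑[ i ] boundary (G i) (layer X i) + s
        ≡⟨ boundary-join 4≤m G M X ⟨
      boundary Γ X ∎
      where
      open ≤-Reasoning
      s : ℕ
      s = ∑ (crossing 4≤m G M X)
      z : Fin m → ℕ
      z i = 𝟙 (1 ≤? ∣ layer X i ∣)
      layer≥ : ∀ i → z i * k ≤ boundary (G i) (layer X i)
      layer≥ i = by-cases (1 ≤? ∣ layer X i ∣)
        where
        by-cases : (d : Dec (1 ≤ ∣ layer X i ∣)) → 𝟙 d * k ≤ boundary (G i) (layer X i)
        by-cases (yes nonempty) = ≤-trans (≤-reflexive (*-identityˡ k)) (layer-boundary X i nonempty (proper i))
        by-cases (no _)         = z≤n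
      layer≤ : ∀ i → 2 * ∣ layer X i ∣ ≤ z i * s
      layer≤ i = by-cases (1 ≤? ∣ layer X i ∣)
        where
        by-cases : (d : Dec (1 ≤ ∣ layer X i ∣)) → 2 * ∣ layer X i ∣ ≤ 𝟙 d * s
        by-cases (yes _)    = ≤-trans (subst (λ t → 2 * ∣ layer X i ∣ ≤ 2 * t + s) empty (variation-from X i q))
                                (≤-reflexive (sym (*-identityˡ s)))
        by-cases (no empty) = ≤-reflexive (cong (2 *_) (n<1⇒n≡0 (≰⇒> empty)))
      total : 2 * ∣ X ∣ ≤ ∑ z * s
      total = begin
        2 * ∣ X ∣                          ≡⟨ cong (2 *_) (∑∣layer∣ {m} X) ⟨
        2 * ∑[ i ] ∣ layer {m} X i ∣       ≡⟨ ∑-*ˡ 2 (λ i → ∣ layer {m} X i ∣) ⟨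
        ∑[ i ] (2 * ∣ layer {m} X i ∣)     ≤⟨ ∑-mono layer≤ ⟩
        ∑[ i ] (z i * s)                   ≡⟨ ∑-*ʳ s z ⟩
        ∑ z * s                            ∎

    -- Twice the ceiling is at least 3k+2, and strictness of the bound on the order adds 2.
    3k+4≤2n : 3 * k + 2 + 2 ≤ 2 * n
    3k+4≤2n = ≤-trans (+-monoˡ-≤ 2 (≤-trans (≤-reflexive (sym (⌊n/2⌋+⌈n/2⌉≡n (3 * k + 2))))
        (+-monoˡ-≤ ⌈ 3 * k + 2 /2⌉ (⌊n/2⌋≤⌈n/2⌉ (3 * k + 2)))))
      (≤-trans (≤-reflexive (identity ⌈ 3 * k + 2 /2⌉)) (*-monoʳ-≤ 2 big))
      where
      identity : ∀ c → c + c + 2 ≡ 2 * suc c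
      identity = solve-∀

  join-boundary : (X : Subset (m * n)) → 4 ≤ ∣ X ∣ → 4 ≤ ∣ ∁ X ∣ → 3 * k + 3 ≤ boundary Γ X
  join-boundary X 4≤ 4≤∁ with any? (λ i → ∣ layer X i ∣ ≟ 0) | any? (λ i → ∣ layer X i ∣ ≟ n)
  ... | yes (q , empty) | yes (p , full) = begin
    3 * k + 3
      ≤⟨ +-monoʳ-≤ (3 * k) (n≤1+n 3) ⟩
    3 * k + 4
      ≡⟨ +-assoc (3 * k) 2 2 ⟨
    3 * k + 2 + 2
      ≤⟨ 3k+4≤2n ⟩
    2 * n
      ≤⟨ subst₂ (λ a b → 2 * a ≤ 2 * b + ∑ (crossing 4≤m G M X)) full empty (variation-from X p q) ⟩
    ∑ (crossing 4≤m G M X)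
      ≤⟨ m≤n+m _ (∑[ i ] boundary (G i) (layer X i)) ⟩
    ∑[ i ] boundary (G i) (layer X i) + ∑ (crossing 4≤m G M X)
      ≡⟨ boundary-join 4≤m G M X ⟨
    boundary Γ X ∎
    where open ≤-Reasoning
  ... | yes (q , empty) | no none-full = no-full-layer X 4≤ q empty
      (λ i → ≤∧≢⇒< (∣p∣≤n (layer X i)) (λ full → none-full (i , full)))
  -- Complementing exchanges full and empty layers, so `p` serves as the empty layer of the
  -- complement.
  ... | no none-empty | yes (p , full) = subst (3 * k + 3 ≤_) (boundary-∁ Γ X)
      (no-full-layer (∁ X) 4≤∁ p
        (+-cancelˡ-≡ n _ 0 (trans (cong (_+ ∣ layer (∁ X) p ∣) (sym full))
          (trans (∣layer∣+∣layer∁∣ X p) (sym (+-identityʳ n)))))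
        (λ i → ≤∧≢⇒< (∣p∣≤n (layer (∁ X) i)) (λ full′ → none-empty (i , +-cancelʳ-≡ n _ 0
          (trans (cong (∣ layer X i ∣ +_) (sym full′)) (∣layer∣+∣layer∁∣ X i))))))
  ... | no none-empty | no none-full = begin
    3 * k + 3
      ≤⟨ +-monoʳ-≤ (3 * k) 3≤k ⟩
    3 * k + k
      ≡⟨ +-comm (3 * k) k ⟩
    4 * k
      ≤⟨ *-monoˡ-≤ k 4≤m ⟩
    m * k
      ≡⟨ ∑-const {m} k ⟨
    ∑ {m} (λ _ → k)
      ≤⟨ ∑-mono (λ i → layer-boundary X i (n≢0⇒n>0 (λ empty → none-empty (i , empty)))
           (≤∧≢⇒< (∣p∣≤n (layer X i)) (λ full → none-full (i , full)))) ⟩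
    ∑[ i ] boundary (G i) (layer X i)
      ≤⟨ m≤m+n _ (∑ (crossing 4≤m G M X)) ⟩
    ∑[ i ] boundary (G i) (layer X i) + ∑ (crossing 4≤m G M X)
      ≡⟨ boundary-join 4≤m G M X ⟨
    boundary Γ X ∎
    where open ≤-Reasoning

theorem4p7 : (m k n : ℕ) (4≤m : 4 ≤ m) → 3 ≤ k →
    (G : Fin m → Graph n) →
    (∀ i → Regular k (G i)) →
    (∀ i → EdgeConnected k (G i)) →
    (∀ i → TriangleFree (G i)) →
    ⌈ 3 * k + 2 /2⌉ < n →
    (M : Fin m → Permutation′ n) →
    Super-λ″ (cyclicJoin (<⇒≤ 4≤m) G M) × Persistence (cyclicJoin (<⇒≤ 4≤m) G M) (k + 1)
theorem4p7 m k n 4≤m 3≤k G reg conn tf big M =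
    super-λ″ 3≤k Γ Γ-regular Γ-triangleFree Γ-boundary v₀
  , persistence 3≤k Γ Γ-regular Γ-triangleFree Γ-boundary v₀
  where
  Γ : Graph (m * n)
  Γ = cyclicJoin (<⇒≤ 4≤m) G M
  Γ-regular : Regular (k + 2) Γ
  Γ-regular = join-regular 4≤m G M reg
  Γ-triangleFree : TriangleFree Γ
  Γ-triangleFree = join-triangleFree 4≤m G M tf
  Γ-boundary : ∀ X → 4 ≤ ∣ X ∣ → 4 ≤ ∣ ∁ X ∣ → 3 * k + 3 ≤ boundary Γ X
  Γ-boundary = join-boundary 4≤m 3≤k G reg conn tf big M
  v₀ : Fin (m * n)
  v₀ = combine (fromℕ< (≤-trans (s≤s z≤n) 4≤m)) (fromℕ< (≤-trans (s≤s z≤n) big))
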